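{- Let $k,t$ be positive integers with $k\geq 4$, and let $\varepsilon>0$. There exist a positive real $\delta$ and an integer $n_0$ such that for all $n\geq n_0$ the following holds: if $\mathcal{F}\subseteq\binom{[n]}{k}$ contains no copy of $\mathbb{P}^{(k)}_{2t+2}$ or contains no copy of $\mathbb{P}^{(k)}_{2t+1}$, and $|\mathcal{F}|\geq(t-\delta)\binom{n}{k-1}$, then there is a set $S\subseteq[n]$ with $|S|=t$ such that all but at most $\varepsilon\binom{n}{k-1}$ members of $\mathcal{F}$ intersect $S$.
   Context: A $k$-uniform linear path of length $\ell$, $\mathbb{P}^{(k)}_\ell$, is a family of $k$-sets $\{F_1,\ldots,F_\ell\}$ with $|F_i\cap F_{i+1}|=1$ for each $i$ and $F_i\cap F_j=\emptyset$ whenever $|i-j|>1$. A family contains a copy of it if some subfamily is isomorphic to it. -}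

module Defs where

open import Data.Nat using (ℕ; zero; suc; _<_; _≟_)
open import Data.Fin using (Fin; toℕ)
open import Data.Fin.Subset using (Subset; _∩_; ∣_∣)
open import Data.List using (List; length; filter)
open import Data.List.Membership.Propositional using (_∈_)
open import Data.List.Relation.Unary.All using (All)
open import Data.List.Relation.Unary.Unique.Propositional using (Unique)
open import Data.Product using (_×_; ∃)
open import Data.Integer using (+_)
open import Data.Rational using (ℚ; _/_)
open import Function.Definitions using (Injective)
open import Relation.Binary.PropositionalEquality using (_≡_)
open import Relation.Nullary using (¬_)

toℚ : ℕ → ℚ
toℚ m = + m / 1

record KFamily (n k : ℕ) : Set where
  field
    members  : List (Subset n)
    distinct : Unique members
    uniform  : All (λ A → ∣ A ∣ ≡ k) members
open KFamily public

size : ∀ {n k} → KFamily n k → ℕ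
size F = length (members F)

IsLinearPath : ∀ {n} (ℓ : ℕ) → (Fin ℓ → Subset n) → Set
IsLinearPath ℓ P =
  Injective _≡_ _≡_ P
  × (∀ i j → toℕ j ≡ suc (toℕ i) → ∣ P i ∩ P j ∣ ≡ 1)
  × (∀ i j → suc (toℕ i) < toℕ j → ∣ P i ∩ P j ∣ ≡ 0)

-- F contains a copy of the linear path of length ℓ (the sets of F are k-sets,
-- so this is a copy of the k-uniform linear path P^(k)_ℓ).
ContainsPath : ∀ {n k} → ℕ → KFamily n k → Set
ContainsPath {n} ℓ F =
  ∃ λ (P : Fin ℓ → Subset n) → IsLinearPath ℓ P × (∀ i → P i ∈ members F)

missCount : ∀ {n k} → KFamily n k → Subset n → ℕ
missCount F S = length (filter (λ A → ∣ A ∩ S ∣ ≟ 0) (members F))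

{-# OPTIONS --safe #-}
-- A path with 2t+2 edges contains one with 2t+1 edges, so F may be assumed free of the longer one.  Join x and y
-- when {x, y} is the kernel of a large sunflower in F.  A path in this graph expands greedily to a linear path in F,
-- so the graph has no path with 2t+2 edges.
--
-- All but O(n^(k−2)) members A of F have a centre: a vertex of A joined to every other vertex of A.  This is the
-- delta-system method, with "robust" position sets (those no bounded set of vertices can block) in the role of kernels.
-- The exceptional members split into boundedly many subfamilies in which the same position sets are robust.  If two
-- positions a, b are such that the complements of {a, b}, {a} and {b} all fail to be robust, the subfamily has
-- O(n^(k−2)) members.  Otherwise, since robust sets are closed under intersection and k ≥ 4, there is either a common
-- centre position or a pair of positions that can be changed alternately to trace a long path in the graph.
--
-- Hence |F| ≤ Σ C(d(x), k−1) + O(n^(k−2)), with d(x) the degree of x, and C(d, k−1) ≤ (d/n)² C(n, k−1).  A path-free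
-- graph has O(n) edges, so boundedly many vertices have linear degree, and all but boundedly many vertices have at most
-- t neighbours among them (otherwise a K_{t+1,m} yields a path), so these degrees sum to at most (t + o(1))n.  As
-- Σ d² ≥ (t − o(1))n², almost all the weight lies on at most t vertices of degree at least n/2.
module Submission where

open import Defs

module Kernels where

  open import Data.Bool using (true)
  import Data.Bool.Properties as Boolₚ
  open import Data.Empty using (⊥-elim)
  open import Data.Fin as Fin using (Fin; zero; suc; toℕ; fromℕ<; inject₁; punchIn; punchOut; funToFin; finToFun)
  import Data.Fin.Properties as Finₚ
  open import Data.Fin.Subset as Sub using (Subset; inside; outside; ∣_∣; _∩_; _∪_; ⁅_⁆)
    renaming (_∈_ to _∈ˢ_; _∉_ to _∉ˢ_; _⊆_ to _⊆ˢ_; _-_ to _-ˢ_)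
  import Data.Fin.Subset.Properties as Subₚ
  open import Data.List as List using (List; []; _∷_; _++_; length; map; filter; allFin; cartesianProduct)
  open import Data.List.Membership.Propositional using (_∈_; _∉_; find; lose)
  open import Data.List.Membership.Propositional.Properties
    using (∈-filter⁺; ∈-filter⁻; ∈-allFin; ∈-++⁺ˡ; ∈-++⁺ʳ; ∈-++⁻; ∈-tabulate⁺; ∈-tabulate⁻; ∈-cartesianProduct⁺)
  import Data.List.Properties as Listₚ
  open import Data.List.Relation.Unary.All as All using (All; []; _∷_)
  import Data.List.Relation.Unary.All.Properties as Allₚ
  open import Data.List.Relation.Unary.AllPairs using ([]; _∷_)
  open import Data.List.Relation.Unary.Any as Any using (Any; here; there)
  open import Data.List.Relation.Unary.Unique.Propositional using (Unique)
  import Data.List.Relation.Unary.Unique.Propositional.Properties as Uniqueₚ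
  open import Data.Nat
  open import Data.Nat.Combinatorics using (_C_; nCk+nC[k+1]≡[n+1]C[k+1]; nC1≡n)
  open import Data.Nat.ListAction using (sum)
  open import Data.Nat.Properties
  open import Data.Nat.Tactic.RingSolver using (solve-∀)
  open import Data.Product using (_×_; _,_; proj₁; proj₂; ∃; ∃-syntax)
  open import Data.Product.Properties using (≡-dec)
  open import Data.Sum using (_⊎_; inj₁; inj₂; [_,_]′)
  open import Data.Unit using (⊤; tt)
  open import Data.Vec as Vec using (Vec; []; _∷_; here; there)
  import Data.Vec.Properties as Vecₚ
  open import Function using (_∘_; id)
  open import Function.Definitions using (Injective)
  open import Relation.Binary.Definitions using (tri<; tri≈; tri>)
  open import Relation.Binary.PropositionalEquality
  open import Relation.Nullary using (¬_; Dec; yes; no; does)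
  open import Relation.Nullary.Decidable using (¬?; _×-dec_; _⊎-dec_; _→-dec_; decidable-stable)
  open import Relation.Unary using (Decidable)

  private
    variable
      A B : Set
      P Q R : A → Set
      c d n : ℕ

  -- Finite sums

  ⟦_⟧ : {X : Set} → Dec X → ℕ
  ⟦ yes _ ⟧ = 1
  ⟦ no  _ ⟧ = 0

  opaque

    ∑ : List A → (A → ℕ) → ℕ
    ∑ xs f = sum (map f xs)

    ∑-[] : {f : A → ℕ} → ∑ [] f ≡ 0
    ∑-[] = refl

    ∑-∷ : ∀ (x : A) xs {f : A → ℕ} → ∑ (x ∷ xs) f ≡ f x + ∑ xs f
    ∑-∷ x xs = refl

    ∑-mono : ∀ (xs : List A) {f g : A → ℕ} → (∀ {x} → x ∈ xs → f x ≤ g x) → ∑ xs f ≤ ∑ xs g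
    ∑-mono []       _   = z≤n
    ∑-mono (x ∷ xs) f≤g = +-mono-≤ (f≤g (here refl)) (∑-mono xs (f≤g ∘ there))

    ∑-const : ∀ (xs : List A) c → ∑ xs (λ _ → c) ≡ length xs * c
    ∑-const []       c = refl
    ∑-const (_ ∷ xs) c = cong (c +_) (∑-const xs c)

    ∑-+ : ∀ (xs : List A) (f g : A → ℕ) → ∑ xs (λ x → f x + g x) ≡ ∑ xs f + ∑ xs g
    ∑-+ []       f g = refl
    ∑-+ (x ∷ xs) f g = begin
      f x + g x + ∑ xs (λ y → f y + g y)  ≡⟨ cong (f x + g x +_) (∑-+ xs f g) ⟩
      f x + g x + (∑ xs f + ∑ xs g)       ≡⟨ +-assoc (f x) (g x) _ ⟩
      f x + (g x + (∑ xs f + ∑ xs g))     ≡⟨ cong (f x +_) (x+[y+z]≡y+[x+z] (g x) (∑ xs f) (∑ xs g)) ⟩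
      f x + (∑ xs f + (g x + ∑ xs g))     ≡⟨ +-assoc (f x) (∑ xs f) _ ⟨
      f x + ∑ xs f + (g x + ∑ xs g)       ∎
      where
      open ≡-Reasoning
      x+[y+z]≡y+[x+z] : ∀ x y z → x + (y + z) ≡ y + (x + z)
      x+[y+z]≡y+[x+z] x y z = trans (sym (+-assoc x y z)) (trans (cong (_+ z) (+-comm x y)) (+-assoc y x z))

    ∑-*ˡ : ∀ (xs : List A) c (f : A → ℕ) → ∑ xs (λ x → c * f x) ≡ c * ∑ xs f
    ∑-*ˡ []       c f = sym (*-zeroʳ c)
    ∑-*ˡ (x ∷ xs) c f = trans (cong (c * f x +_) (∑-*ˡ xs c f)) (sym (*-distribˡ-+ c (f x) (∑ xs f)))

    ∑-swap : ∀ (xs : List A) (ys : List B) (f : A → B → ℕ) →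
             ∑ xs (λ x → ∑ ys (f x)) ≡ ∑ ys (λ y → ∑ xs (λ x → f x y))
    ∑-swap []       ys f = sym (trans (∑-const ys 0) (*-zeroʳ (length ys)))
    ∑-swap (x ∷ xs) ys f =
      trans (cong (∑ ys (f x) +_) (∑-swap xs ys f)) (sym (∑-+ ys (f x) (λ y → ∑ xs (λ x → f x y))))

    ∑-filter-≤ : ∀ (P? : Decidable P) (xs : List A) (f : A → ℕ) → ∑ (filter P? xs) f ≤ ∑ xs f
    ∑-filter-≤ P? []       f = z≤n
    ∑-filter-≤ P? (x ∷ xs) f with P? x
    ... | yes _ = +-monoʳ-≤ (f x) (∑-filter-≤ P? xs f)
    ... | no  _ = ≤-trans (∑-filter-≤ P? xs f) (m≤n+m _ (f x))

    ∑-⟦⟧ : ∀ (P? : Decidable P) (xs : List A) → ∑ xs (λ x → ⟦ P? x ⟧) ≡ length (filter P? xs)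
    ∑-⟦⟧ P? []       = refl
    ∑-⟦⟧ P? (x ∷ xs) with P? x
    ... | yes _ = cong suc (∑-⟦⟧ P? xs)
    ... | no  _ = ∑-⟦⟧ P? xs

    ∑-⟦⟧-* : ∀ (P? : Decidable P) (f : A → ℕ) (xs : List A) →
             ∑ xs (λ x → ⟦ P? x ⟧ * f x) ≡ ∑ (filter P? xs) f
    ∑-⟦⟧-* P? f []       = refl
    ∑-⟦⟧-* P? f (x ∷ xs) with P? x
    ... | yes _ = cong₂ _+_ (+-identityʳ (f x)) (∑-⟦⟧-* P? f xs)
    ... | no  _ = ∑-⟦⟧-* P? f xs

  -- Bounding the number of elements satisfying a predicate

  -- A cardinality bound phrased through duplicate-free lists, so that it makes sense for a
  -- predicate on any type without an enumeration of its elements.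
  AtMost : ℕ → (A → Set) → Set
  AtMost c P = ∀ L → Unique L → All P L → length L ≤ c

  atMost-mono : (∀ {x} → P x → Q x) → c ≤ d → AtMost c Q → AtMost d P
  atMost-mono P⊆Q c≤d h L u all = ≤-trans (h L u (All.map P⊆Q all)) c≤d

  atMost-0 : (∀ {x} → ¬ P x) → AtMost 0 P
  atMost-0 ¬P []      _ _        = z≤n
  atMost-0 ¬P (x ∷ L) _ (px ∷ _) = ⊥-elim (¬P px)

  atMost-1 : (∀ {x y} → P x → P y → x ≡ y) → AtMost 1 P
  atMost-1 eq []          _              _              = z≤n
  atMost-1 eq (x ∷ [])    _              _              = s≤s z≤n
  atMost-1 eq (x ∷ y ∷ L) ((x≢y ∷ _) ∷ _) (px ∷ py ∷ _) = ⊥-elim (x≢y (eq px py))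

  -- The empty list satisfies every bound, and a nonempty one supplies a witness. This is how a
  -- representative of a class is chosen before the class is counted.
  atMost-inhabited : (∀ {x} → P x → AtMost c P) → AtMost c P
  atMost-inhabited h []      _ _            = z≤n
  atMost-inhabited h (x ∷ L) u all@(px ∷ _) = h px (x ∷ L) u all

  length-filter-split : (P? : Decidable P) (xs : List A) →
                        length xs ≡ length (filter P? xs) + length (filter (¬? ∘ P?) xs)
  length-filter-split P? []       = refl
  length-filter-split P? (x ∷ xs) with P? x
  ... | yes _ = cong suc (length-filter-split P? xs)
  ... | no  _ = trans (cong suc (length-filter-split P? xs)) (sym (+-suc _ _))

  atMost-⊎ : Decidable P → (∀ {x} → R x → P x ⊎ Q x) →
             AtMost c P → AtMost d Q → AtMost (c + d) R
  atMost-⊎ {P = P} {Q = Q} {c = c} {d = d} P? R⊆ hP hQ L u all = begin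
    length L                                              ≡⟨ length-filter-split P? L ⟩
    length (filter P? L) + length (filter (¬? ∘ P?) L)    ≤⟨ +-mono-≤ fst snd ⟩
    c + d                                                 ∎
    where
    open ≤-Reasoning
    fst = hP (filter P? L) (Uniqueₚ.filter⁺ P? u) (Allₚ.all-filter P? L)
    toQ : ∀ {x} → x ∈ filter (¬? ∘ P?) L → Q x
    toQ x∈ with x∈L , ¬px ← ∈-filter⁻ (¬? ∘ P?) {xs = L} x∈ with R⊆ (All.lookup all x∈L)
    ... | inj₁ px = ⊥-elim (¬px px)
    ... | inj₂ qx = qx
    snd = hQ (filter (¬? ∘ P?) L) (Uniqueₚ.filter⁺ (¬? ∘ P?) u) (All.tabulate toQ)

  opaque
    unfolding ∑

    atMost-⋃ : (I : List B) {P : B → A → Set} → (∀ i → Decidable (P i)) → (c : B → ℕ) →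
               (∀ {i} → i ∈ I → AtMost (c i) (P i)) →
               AtMost (∑ I c) (λ x → ∃[ i ] (i ∈ I × P i x))
    atMost-⋃ []      P? c h = atMost-0 λ { (_ , () , _) }
    atMost-⋃ (i ∷ I) P? c h = atMost-⊎ (P? i)
      (λ { (_ , here refl , px) → inj₁ px ; (j , there j∈ , px) → inj₂ (j , j∈ , px) })
      (h (here refl)) (atMost-⋃ I P? c (h ∘ there))

  atMost-⋃-const : (I : List B) {P : B → A → Set} → (∀ i → Decidable (P i)) → ∀ c →
                   (∀ {i} → i ∈ I → AtMost c (P i)) →
                   AtMost (length I * c) (λ x → ∃[ i ] (i ∈ I × P i x))
  atMost-⋃-const I P? c h =
    atMost-mono id (≤-reflexive (∑-const I c)) (atMost-⋃ I P? (λ _ → c) h)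

  map-unique : (f : A → B) → (∀ {x y} → P x → P y → f x ≡ f y → x ≡ y) →
               ∀ {L} → All P L → Unique L → Unique (map f L)
  map-unique f inj []         []       = []
  map-unique f inj (px ∷ pxs) (ux ∷ u) =
    Allₚ.map⁺ (All.zipWith (λ (x≢y , py) → x≢y ∘ inj px py) (ux , pxs)) ∷ map-unique f inj pxs u

  atMost-inj : (f : A → B) → (∀ {x y} → P x → P y → f x ≡ f y → x ≡ y) →
               (∀ {x} → P x → Q (f x)) → AtMost c Q → AtMost c P
  atMost-inj {c = c} f inj P⇒Q h L u all =
    subst (_≤ c) (Listₚ.length-map f L)
      (h (map f L) (map-unique f inj all u) (Allₚ.map⁺ (All.map P⇒Q all)))

  atMost-∈ : (∀ (x y : A) → Dec (x ≡ y)) → (xs : List A) → AtMost (length xs) (_∈ xs)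
  atMost-∈ _≟A_ xs = atMost-mono (λ {x} x∈ → x , x∈ , refl) (≤-reflexive (*-identityʳ _))
    (atMost-⋃-const xs (λ i x → x ≟A i) 1 λ _ → atMost-1 λ { refl refl → refl })

  _∈?_ : ∀ (x : Fin n) (xs : List (Fin n)) → Dec (x ∈ xs)
  x ∈? xs = Any.any? (x Finₚ.≟_) xs

  -- Otherwise `Y` would be a duplicate-free list inside `Z`, hence no longer than `Z`. All greedy
  -- choices of vertices below rest on this.
  pick-fresh : {Y : List (Fin n)} → Unique Y → ∀ Z → length Z < length Y → ∃[ y ] (y ∈ Y × y ∉ Z)
  pick-fresh {Y = Y} u Z lt with Any.any? (¬? ∘ (_∈? Z)) Y
  ... | yes p = find p
  ... | no ¬p = ⊥-elim (<⇒≱ lt (atMost-∈ Finₚ._≟_ Z Y u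
      (All.tabulate λ {y} y∈ → decidable-stable (y ∈? Z) λ y∉ → ¬p (Any.map (λ { refl → y∉ }) y∈))))

  -- Binomial coefficients count subsets

  atMost-subsets : ∀ (N : Subset n) j → AtMost (∣ N ∣ C j) (λ A → A ⊆ˢ N × ∣ A ∣ ≡ j)
  atMost-subsets []            zero    = atMost-1 λ { {[]} {[]} _ _ → refl }
  atMost-subsets []            (suc j) = atMost-0 λ { {[]} (_ , ()) }
  atMost-subsets (outside ∷ N) j       =
    atMost-inj {Q = λ A → A ⊆ˢ N × ∣ A ∣ ≡ j} Vec.tail
      (λ { {x ∷ _} {y ∷ _} (p , _) (q , _) refl → cong (_∷ _) (trans (out p) (sym (out q))) })
      (λ { {inside ∷ A} (p , _) → ⊥-elim (absurd p) ; {outside ∷ A} (p , eq) → Subₚ.drop-∷-⊆ p , eq })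
      (atMost-subsets N j)
    where
    absurd : ∀ {A} → ¬ ((inside ∷ A) ⊆ˢ (outside ∷ N))
    absurd p with () ← p here
    out : ∀ {x A} → (x ∷ A) ⊆ˢ (outside ∷ N) → x ≡ outside
    out {inside}  p = ⊥-elim (absurd p)
    out {outside} p = refl
  atMost-subsets (inside ∷ N) zero =
    atMost-inj {Q = λ A → A ⊆ˢ N × ∣ A ∣ ≡ 0} Vec.tail
      (λ { {outside ∷ _} {outside ∷ _} _ _ refl → refl ; {inside ∷ _} (_ , ()) ; {outside ∷ _} {inside ∷ _} _ (_ , ()) })
      (λ { {outside ∷ A} (p , eq) → Subₚ.drop-∷-⊆ p , eq })
      (atMost-subsets N zero)
  -- Pascal's rule: the subsets split by whether they contain the first element.
  atMost-subsets (inside ∷ N) (suc j) =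
    atMost-mono id (≤-reflexive (nCk+nC[k+1]≡[n+1]C[k+1] ∣ N ∣ j))
      (atMost-⊎ {P = λ A → (Vec.head A ≡ inside) × A ⊆ˢ (inside ∷ N) × ∣ A ∣ ≡ suc j}
                {Q = λ A → (Vec.head A ≡ outside) × A ⊆ˢ (inside ∷ N) × ∣ A ∣ ≡ suc j}
        (λ A → (Vec.head A Boolₚ.≟ inside) ×-dec (A Subₚ.⊆? (inside ∷ N)) ×-dec (∣ A ∣ ≟ suc j))
        (λ { {inside ∷ A} r → inj₁ (refl , r) ; {outside ∷ A} r → inj₂ (refl , r) })
        (atMost-inj {Q = λ A → A ⊆ˢ N × ∣ A ∣ ≡ j} Vec.tail
          (λ { {x ∷ _} {y ∷ _} (refl , _) (refl , _) refl → refl })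
          (λ { {inside ∷ A} (_ , p , eq) → Subₚ.drop-∷-⊆ p , suc-injective eq })
          (atMost-subsets N j))
        (atMost-inj {Q = λ A → A ⊆ˢ N × ∣ A ∣ ≡ suc j} Vec.tail
          (λ { {x ∷ _} {y ∷ _} (refl , _) (refl , _) refl → refl })
          (λ { {outside ∷ A} (_ , p , eq) → Subₚ.drop-∷-⊆ p , eq })
          (atMost-subsets N (suc j))))

  -- Enumerating the elements of a subset

  elements : (A : Subset n) → Vec (Fin n) ∣ A ∣
  elements []            = []
  elements (inside  ∷ A) = zero ∷ Vec.map suc (elements A)
  elements (outside ∷ A) = Vec.map suc (elements A)

  lookup-map-suc : ∀ {m} (xs : Vec (Fin n) m) i → Vec.lookup (Vec.map Fin.suc xs) i ≡ Fin.suc (Vec.lookup xs i)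
  lookup-map-suc xs i = Vecₚ.lookup-map i Fin.suc xs

  elements-sound : ∀ (A : Subset n) i → Vec.lookup (elements A) i ∈ˢ A
  elements-sound (inside  ∷ A) zero    = here
  elements-sound (inside  ∷ A) (suc i) =
    subst (Sub._∈ (inside ∷ A)) (sym (lookup-map-suc (elements A) i)) (there (elements-sound A i))
  elements-sound (outside ∷ A) i       =
    subst (Sub._∈ (outside ∷ A)) (sym (lookup-map-suc (elements A) i)) (there (elements-sound A i))

  elements-complete : ∀ (A : Subset n) {x} → x ∈ˢ A → ∃[ i ] (Vec.lookup (elements A) i ≡ x)
  elements-complete (inside  ∷ A) here       = zero , refl
  elements-complete (inside  ∷ A) (there x∈) =
    let i , eq = elements-complete A x∈ in suc i , trans (lookup-map-suc (elements A) i) (cong suc eq)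
  elements-complete (outside ∷ A) (there x∈) =
    let i , eq = elements-complete A x∈ in i , trans (lookup-map-suc (elements A) i) (cong suc eq)

  lookup-map-suc-injective : ∀ {m} (xs : Vec (Fin n) m) {i j} →
    Vec.lookup (Vec.map Fin.suc xs) i ≡ Vec.lookup (Vec.map Fin.suc xs) j → Vec.lookup xs i ≡ Vec.lookup xs j
  lookup-map-suc-injective xs {i} {j} eq =
    Finₚ.suc-injective (trans (sym (lookup-map-suc xs i)) (trans eq (lookup-map-suc xs j)))

  elements-injective : ∀ (A : Subset n) {i j} → Vec.lookup (elements A) i ≡ Vec.lookup (elements A) j → i ≡ j
  elements-injective (inside  ∷ A) {zero}  {zero}  _  = refl
  elements-injective (inside  ∷ A) {zero}  {suc j} eq =
    ⊥-elim (Finₚ.0≢1+n (trans eq (lookup-map-suc (elements A) j)))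
  elements-injective (inside  ∷ A) {suc i} {zero}  eq =
    ⊥-elim (Finₚ.0≢1+n (trans (sym eq) (lookup-map-suc (elements A) i)))
  elements-injective (inside  ∷ A) {suc i} {suc j} eq =
    cong suc (elements-injective A (lookup-map-suc-injective (elements A) eq))
  elements-injective (outside ∷ A)                 eq =
    elements-injective A (lookup-map-suc-injective (elements A) eq)

  ∣p∪q∣≤∣p∣+∣q∣ : ∀ (p q : Subset n) → ∣ p Sub.∪ q ∣ ≤ ∣ p ∣ + ∣ q ∣
  ∣p∪q∣≤∣p∣+∣q∣ []            []            = z≤n
  ∣p∪q∣≤∣p∣+∣q∣ (outside ∷ p) (outside ∷ q) = ∣p∪q∣≤∣p∣+∣q∣ p q
  ∣p∪q∣≤∣p∣+∣q∣ (outside ∷ p) (inside  ∷ q) = ≤-trans (s≤s (∣p∪q∣≤∣p∣+∣q∣ p q)) (≤-reflexive (sym (+-suc _ _)))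
  ∣p∪q∣≤∣p∣+∣q∣ (inside  ∷ p) (outside ∷ q) = s≤s (∣p∪q∣≤∣p∣+∣q∣ p q)
  ∣p∪q∣≤∣p∣+∣q∣ (inside  ∷ p) (inside  ∷ q) =
    s≤s (≤-trans (∣p∪q∣≤∣p∣+∣q∣ p q) (+-monoʳ-≤ ∣ p ∣ (n≤1+n _)))

  image : ∀ {m} → (Fin m → Fin n) → Subset n
  image {m = zero}  x = Sub.⊥
  image {m = suc m} x = Sub.⁅ x zero ⁆ Sub.∪ image (x ∘ suc)

  ∈-image : ∀ {m} (x : Fin m → Fin n) i → x i ∈ˢ image x
  ∈-image x zero    = Subₚ.p⊆p∪q _ (Subₚ.x∈⁅x⁆ _)
  ∈-image x (suc i) = Subₚ.q⊆p∪q Sub.⁅ x zero ⁆ _ (∈-image (x ∘ suc) i)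

  ∣image∣≤ : ∀ {m} (x : Fin m → Fin n) → ∣ image x ∣ ≤ m
  ∣image∣≤ {n} {m = zero}  x = ≤-reflexive (Subₚ.∣⊥∣≡0 n)
  ∣image∣≤ {m = suc m} x = begin
    ∣ Sub.⁅ x zero ⁆ Sub.∪ image (x ∘ suc) ∣        ≤⟨ ∣p∪q∣≤∣p∣+∣q∣ Sub.⁅ x zero ⁆ _ ⟩
    ∣ Sub.⁅ x zero ⁆ ∣ + ∣ image (x ∘ suc) ∣        ≡⟨ cong (_+ ∣ image (x ∘ suc) ∣) (Subₚ.∣⁅x⁆∣≡1 (x zero)) ⟩
    suc ∣ image (x ∘ suc) ∣                         ≤⟨ s≤s (∣image∣≤ (x ∘ suc)) ⟩
    suc m                                           ∎
    where open ≤-Reasoning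

  elementList : ∀ {n} → Subset n → List (Fin n)
  elementList Z = List.tabulate (Vec.lookup (elements Z))

  ∈-elementList : ∀ {n} {Z : Subset n} {x} → x ∈ˢ Z → x ∈ elementList Z
  ∈-elementList {Z = Z} x∈ with i , refl ← elements-complete Z x∈ = ∈-tabulate⁺ i

  atMost-valued-in : ∀ {n} (Z : Subset n) (f : A → Fin n) → Decidable P →
                     (∀ z → AtMost c (λ x → P x × f x ≡ z)) → AtMost (∣ Z ∣ * c) (λ x → P x × f x ∈ˢ Z)
  atMost-valued-in {c = c} Z f P? h =
    atMost-mono (λ {x} (px , fx∈) → f x , ∈-elementList fx∈ , px , refl)
      (≤-reflexive (cong (_* c) (Listₚ.length-tabulate (Vec.lookup (elements Z)))))
      (atMost-⋃-const (elementList Z) (λ z x → P? x ×-dec (f x Finₚ.≟ z)) c λ {z} _ → h z)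

  -- Splitting a family into subfamilies with uniform robustness

  boundFactor : ℕ → ℕ
  boundFactor zero    = 1
  boundFactor (suc a) = 1 + suc a * boundFactor a

  module Homogeneity {X : Set} (_≟X_ : ∀ (x y : X) → Dec (x ≡ y))
                     {n k : ℕ} (v : X → Fin k → Fin n) (s : ℕ) where

    -- The positions that may change. Equal entries are allowed, and `(a , a)` stands for the single
    -- position `a`.
    Pair : Set
    Pair = Fin k × Fin k

    _≟P_ : ∀ (I J : Pair) → Dec (I ≡ J)
    _≟P_ = ≡-dec Finₚ._≟_ Finₚ._≟_

    _∈X?_ : ∀ (x : X) (xs : List X) → Dec (x ∈ xs)
    x ∈X? xs = Any.any? (x ≟X_) xs

    Agree : Pair → X → X → Set
    Agree (a , b) e f = ∀ p → p ≢ a → p ≢ b → v f p ≡ v e p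

    Agree? : ∀ I e f → Dec (Agree I e f)
    Agree? (a , b) e f = Finₚ.all? λ p → ¬? (p Finₚ.≟ a) →-dec ¬? (p Finₚ.≟ b) →-dec (v f p Finₚ.≟ v e p)

    Hits : Pair → Subset n → X → Set
    Hits (a , b) Z f = v f a ∈ˢ Z ⊎ v f b ∈ˢ Z

    Hits? : ∀ I Z f → Dec (Hits I Z f)
    Hits? (a , b) Z f = (v f a Subₚ.∈? Z) ⊎-dec (v f b Subₚ.∈? Z)

    -- The complement of the position set {a, b} fails to be the kernel of a large sunflower through e:
    -- few vertices meet every member of G that agrees with e outside {a, b}.
    Covered : List X → Pair → X → Set
    Covered G I e = ∃[ Z ] (∣ Z ∣ ≤ s × All (λ f → Agree I e f → Hits I Z f) G)

    Covered? : ∀ G I e → Dec (Covered G I e)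
    Covered? G I e = Subₚ.anySubset? λ Z → (∣ Z ∣ ≤? s) ×-dec All.all? (λ f → Agree? I e f →-dec Hits? I Z f) G

    covered-⊆ : ∀ {G G′ I e} → (∀ {f} → f ∈ G′ → f ∈ G) → Covered G I e → Covered G′ I e
    covered-⊆ G′⊆G (Z , Z≤s , all) = Z , Z≤s , All.tabulate (All.lookup all ∘ G′⊆G)

    -- Agreement outside `I` is transitive, so one blocking set serves the whole agreement class.
    -- Peeling therefore removes entire classes.
    covered-agree : ∀ {G I e f} → Agree I e f → Covered G I f → Covered G I e
    covered-agree {G} {I} {e} {f} e~f (Z , Z≤s , all) =
      Z , Z≤s , All.map (λ h e~g → h (λ p p≢a p≢b → trans (e~g p p≢a p≢b) (sym (e~f p p≢a p≢b)))) all

    -- The positive form in which robustness is used: a finite search of `G` turns the absence of a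
    -- blocking set into an actual member avoiding `Z`.
    uncovered-escape : ∀ {G I e} → ¬ Covered G I e → ∀ Z → ∣ Z ∣ ≤ s →
                       ∃[ f ] (f ∈ G × Agree I e f × ¬ Hits I Z f)
    uncovered-escape {G} {I} {e} ¬cov Z Z≤s with Any.any? (λ f → Agree? I e f ×-dec ¬? (Hits? I Z f)) G
    ... | yes p = find p
    ... | no ¬p = ⊥-elim (¬cov (Z , Z≤s , All.map
      (λ {f} ¬q e~f → decidable-stable (Hits? I Z f) λ ¬h → ¬q (e~f , ¬h)) (Allₚ.¬Any⇒All¬ G ¬p)))

    -- Robustness is measured inside `core` and coveredness inside `part I`, so that each piece can
    -- be treated as a family of its own.
    record Decomposition (𝒜 : List Pair) (G : List X) : Set where
      field
        core         : List X
        part         : Pair → List X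
        cover        : ∀ {e} → e ∈ G → e ∈ core ⊎ ∃[ I ] (I ∈ 𝒜 × e ∈ part I)
        core⊆        : ∀ {e} → e ∈ core → e ∈ G
        part⊆        : ∀ {I e} → e ∈ part I → e ∈ G
        core-robust  : ∀ {I e} → I ∈ 𝒜 → e ∈ core → ¬ Covered core I e
        part-covered : ∀ {I e} → e ∈ part I → Covered (part I) I e

    open Decomposition

    module PeelOff {𝒜 : List Pair} {G : List X} {I : Pair} (I∈ : I ∈ 𝒜)
                   (D : Decomposition 𝒜 (filter (¬? ∘ Covered? G I) G)) where

      peeled kept : List X
      peeled = filter (Covered? G I) G
      kept   = filter (¬? ∘ Covered? G I) G

      kept⊆ : ∀ {e} → e ∈ kept → e ∈ G
      kept⊆ = proj₁ ∘ ∈-filter⁻ (¬? ∘ Covered? G I) {xs = G}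

      new-part : Pair → List X
      new-part J = filter (λ _ → J ≟P I) peeled ++ part D J

      ∈-new-part⁻ : ∀ J {e} → e ∈ new-part J → (J ≡ I × e ∈ peeled) ⊎ e ∈ part D J
      ∈-new-part⁻ J e∈ with ∈-++⁻ (filter (λ _ → J ≟P I) peeled) e∈
      ... | inj₁ e∈ˡ = let e∈p , J≡I = ∈-filter⁻ (λ _ → J ≟P I) {xs = peeled} e∈ˡ in inj₁ (J≡I , e∈p)
      ... | inj₂ e∈ʳ = inj₂ e∈ʳ

      new⊆ : ∀ J {e} → e ∈ new-part J → e ∈ G
      new⊆ J e∈ with ∈-new-part⁻ J e∈
      ... | inj₁ (_ , e∈p) = proj₁ (∈-filter⁻ (Covered? G I) {xs = G} e∈p)
      ... | inj₂ e∈p       = kept⊆ (part⊆ D e∈p)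

      -- A member of the old part agrees outside I with no peeled one, because whole agreement classes are peeled.
      new-covered : ∀ J {e} → e ∈ new-part J → Covered (new-part J) J e
      new-covered J {e} e∈ with ∈-new-part⁻ J e∈
      ... | inj₁ (refl , e∈p) =
        covered-⊆ {G} {new-part J} {J} {e} (new⊆ J) (proj₂ (∈-filter⁻ (Covered? G J) {xs = G} e∈p))
      ... | inj₂ e∈p with Z , Z≤s , all ← part-covered D e∈p = Z , Z≤s , All.tabulate hit
        where
        hit : ∀ {f} → f ∈ new-part J → Agree J e f → Hits J Z f
        hit f∈ e~f with ∈-new-part⁻ J f∈
        ... | inj₂ f∈p          = All.lookup all f∈p e~f
        ... | inj₁ (refl , f∈p) = ⊥-elim (proj₂ (∈-filter⁻ (¬? ∘ Covered? G J) {xs = G} (part⊆ D e∈p))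
                (covered-agree {G} {J} e~f (proj₂ (∈-filter⁻ (Covered? G J) {xs = G} f∈p))))

      extended : Decomposition 𝒜 G
      extended .core         = core D
      extended .part         = new-part
      extended .cover {e} e∈ with Covered? G I e
      ... | yes cov = inj₂ (I , I∈ , ∈-++⁺ˡ (∈-filter⁺ (λ _ → I ≟P I) (∈-filter⁺ (Covered? G I) e∈ cov) refl))
      ... | no ¬cov with cover D (∈-filter⁺ (¬? ∘ Covered? G I) e∈ ¬cov)
      ...   | inj₁ e∈c            = inj₁ e∈c
      ...   | inj₂ (J , J∈ , e∈p) = inj₂ (J , J∈ , ∈-++⁺ʳ (filter (λ _ → J ≟P I) peeled) e∈p)
      extended .core⊆        = kept⊆ ∘ core⊆ D
      extended .part⊆ {J}    = new⊆ J
      extended .core-robust  = core-robust D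
      extended .part-covered {J} = new-covered J

    -- As long as some pair of `𝒜` is covered at some member, the members covered for it are peeled
    -- off. Each peeling shortens the list, whose length is bounded by the recursion argument `m`.
    decompose : ∀ m 𝒜 G → length G ≤ m → Decomposition 𝒜 G
    decompose m 𝒜 G G≤m with Any.any? (λ I → Any.any? (Covered? G I) G) 𝒜
    ... | no ¬p = record
      { core         = G
      ; part         = λ _ → []
      ; cover        = inj₁
      ; core⊆        = id
      ; part⊆        = λ ()
      ; core-robust  = λ I∈ e∈ cov → ¬p (Any.map (λ { refl → Any.map (λ { refl → cov }) e∈ }) I∈)
      ; part-covered = λ ()
      }
    decompose zero    𝒜 [] z≤n | yes p with () ← proj₂ (proj₂ (find p))
    decompose (suc m) 𝒜 G  G≤m | yes p with I , I∈ , q ← find p =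
      PeelOff.extended I∈ (decompose m 𝒜 (filter (¬? ∘ Covered? G I) G)
        (≤-pred (≤-trans (Listₚ.filter-notAll (¬? ∘ Covered? G I) G (Any.map (λ cov ¬cov → ¬cov cov) q)) G≤m)))

    -- The bound is only required of homogeneous families: each pair is robust at all members or
    -- covered at all members, and `𝒜` consists of the robust ones.
    RobustBound : (X → Set) → ℕ → Set
    RobustBound Q c = ∀ 𝒜 H → (∀ {e} → e ∈ H → Q e) →
      (∀ {I e} → I ∈ 𝒜 → e ∈ H → ¬ Covered H I e) →
      (∀ {I e} → I ∉ 𝒜 → e ∈ H → Covered H I e) →
      AtMost c (_∈ H)

    -- Induction on the number of pairs not yet known to be covered. The core is homogeneous and has
    -- at most `c` members. In `part I` the pair `I` has become covered and leaves `𝒜`, so the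
    -- induction hypothesis applies to each of the at most `suc a` parts. `boundFactor` solves the
    -- resulting recursion.
    homogeneous-bound : ∀ {Q c} → RobustBound Q c → ∀ a 𝒜 G → length 𝒜 ≤ a → (∀ {e} → e ∈ G → Q e) →
      (∀ {I e} → I ∉ 𝒜 → e ∈ G → Covered G I e) → AtMost (boundFactor a * c) (_∈ G)
    homogeneous-bound {c = c} rb zero [] G z≤n Q-G dead =
      atMost-mono id (≤-reflexive (sym (*-identityˡ c))) (rb [] G Q-G (λ ()) dead)
    homogeneous-bound {Q} {c} rb (suc a) 𝒜 G 𝒜≤a Q-G dead =
      atMost-mono id arith
        (atMost-⊎ (_∈X? core D) (cover D)
          (rb 𝒜 (core D) (Q-G ∘ core⊆ D) (core-robust D)
              (λ {I} {e} I∉ e∈ → covered-⊆ {G} {core D} {I} {e} (core⊆ D) (dead I∉ (core⊆ D e∈))))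
          (atMost-⋃-const 𝒜 (λ I e → e ∈X? part D I) (boundFactor a * c) part-bound))
      where
      D = decompose (length G) 𝒜 G ≤-refl
      without : Pair → List Pair
      without I = filter (λ J → ¬? (J ≟P I)) 𝒜
      part-bound : ∀ {I} → I ∈ 𝒜 → AtMost (boundFactor a * c) (_∈ part D I)
      part-bound {I} I∈ = homogeneous-bound {Q} rb a (without I) (part D I)
        (≤-pred (≤-trans (Listₚ.filter-notAll (λ J → ¬? (J ≟P I)) 𝒜 (Any.map (λ eq J≢I → J≢I (sym eq)) I∈)) 𝒜≤a))
        (Q-G ∘ part⊆ D) dead′
        where
        dead′ : ∀ {J e} → J ∉ without I → e ∈ part D I → Covered (part D I) J e
        dead′ {J} {e} J∉ e∈ with J ≟P I
        ... | yes refl = part-covered D e∈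
        ... | no J≢I   = covered-⊆ {G} {part D I} {J} {e} (part⊆ D)
          (dead (λ J∈ → J∉ (∈-filter⁺ (λ J → ¬? (J ≟P I)) J∈ J≢I)) (part⊆ D e∈))
      arith : c + length 𝒜 * (boundFactor a * c) ≤ boundFactor (suc a) * c
      arith = +-monoʳ-≤ c (≤-trans (*-monoˡ-≤ (boundFactor a * c) 𝒜≤a)
        (≤-reflexive (sym (*-assoc (suc a) (boundFactor a) c))))

  -- Paths in a graph, with their length counted in edges

  record Path {n : ℕ} (Adj : Fin n → Fin n → Set) (ℓ : ℕ) : Set where
    field
      vertex    : Fin (suc ℓ) → Fin n
      injective : Injective _≡_ _≡_ vertex
      adjacent  : ∀ i → Adj (vertex (inject₁ i)) (vertex (suc i))

  open Path

  module _ {n : ℕ} {Adj : Fin n → Fin n → Set} where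

    path-single : Fin n → Path Adj 0
    path-single x .vertex    _                 = x
    path-single x .injective {zero} {zero} _   = refl
    path-single x .adjacent  ()

    path-cons : ∀ {ℓ} u (p : Path Adj ℓ) → Adj u (vertex p zero) → (∀ i → u ≢ vertex p i) → Path Adj (suc ℓ)
    path-cons u p adj fresh .vertex zero    = u
    path-cons u p adj fresh .vertex (suc i) = vertex p i
    path-cons u p adj fresh .injective {zero}  {zero}  _  = refl
    path-cons u p adj fresh .injective {zero}  {suc j} eq = ⊥-elim (fresh j eq)
    path-cons u p adj fresh .injective {suc i} {zero}  eq = ⊥-elim (fresh i (sym eq))
    path-cons u p adj fresh .injective {suc i} {suc j} eq = cong suc (injective p eq)
    path-cons u p adj fresh .adjacent zero    = adj
    path-cons u p adj fresh .adjacent (suc i) = adjacent p i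

  -- The dichotomy for positions: a common centre or an alternating pair

  module PositionTypes {k : ℕ} (3<k : 3 < k) (R : Fin k → Fin k → Set) (R? : ∀ a b → Dec (R a b))
                       (R-cover : ∀ a b → a ≢ b → R a b ⊎ R a a ⊎ R b b) where

    -- With `R a b` read as robustness of the complement of `{a, b}`, this expresses `{c, y}` as an
    -- intersection of robust sets: every other position can be changed, alone or with a partner,
    -- while `c` and `y` stay fixed.
    Free : Fin k → Fin k → Set
    Free c y = ∀ z → z ≢ c → z ≢ y → ∃[ z′ ] (z′ ≢ c × z′ ≢ y × R z z′)

    Star : Set
    Star = ∃[ c ] (∀ y → y ≢ c → Free c y)

    -- Both `w` and `w′` can be changed alone, and together they form a kernel. Changing them in
    -- turn traces a path.
    Twins : Set
    Twins = ∃[ w ] ∃[ w′ ] (w ≢ w′ × R w w × R w′ w′ × Free w w′)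

    -- Three positions cannot exhaust the `k` positions; here the assumption that `k` is at least 4
    -- enters.
    fourth : ∀ a b c → ∃[ d ] (d ≢ a × d ≢ b × d ≢ c)
    fourth a b c with d , _ , d∉ ← pick-fresh (Uniqueₚ.allFin⁺ k) (a ∷ b ∷ c ∷ [])
                                     (subst (3 <_) (sym (Listₚ.length-tabulate {n = k} id)) 3<k) =
      d , (λ d≡a → d∉ (here d≡a)) , (λ d≡b → d∉ (there (here d≡b))) , (λ d≡c → d∉ (there (there (here d≡c))))

    -- If c absorbs every loop of R, then any z ≠ c is matched by any fourth position.
    star-at : ∀ c → (∀ z → z ≢ c → ¬ R z z) → Star
    star-at c loopless = c , λ y y≢c z z≢c z≢y → let z′ , z′≢c , z′≢y , z′≢z = fourth c y z in
      z′ , z′≢c , z′≢y , [ id , [ ⊥-elim ∘ loopless z z≢c , ⊥-elim ∘ loopless z′ z′≢c ]′ ]′ (R-cover z z′ (z′≢z ∘ sym))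

    star-loops : ∀ c → (∀ z → z ≢ c → R z z) → Star
    star-loops c loops = c , λ y y≢c z z≢c z≢y → z , z≢c , z≢y , loops z z≢c

    some : Fin k
    some = Fin.fromℕ< {0} (≤-trans (s≤s z≤n) 3<k)

    at-most-one : {S : Fin k → Set} → Decidable S → ¬ (∃[ a ] ∃[ b ] (a ≢ b × S a × S b)) →
                  ∃[ c ] (∀ z → z ≢ c → ¬ S z)
    at-most-one S? ¬two with Finₚ.any? S?
    ... | yes (c , Sc) = c , λ z z≢c Sz → ¬two (z , c , z≢c , Sz , Sc)
    ... | no ¬S        = some , λ z _ Sz → ¬S (z , Sz)

    two? : {S : Fin k → Set} → Decidable S → Dec (∃[ a ] ∃[ b ] (a ≢ b × S a × S b))
    two? S? = Finₚ.any? λ a → Finₚ.any? λ b → ¬? (a Finₚ.≟ b) ×-dec S? a ×-dec S? b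

    -- With at most one loop of `R`, that loop is a centre. With at most one non-loop, that non-loop
    -- is a centre. Otherwise there are two loops `w`, `w′` and two non-loops; by `R-cover` any two
    -- distinct non-loops are related, so every non-loop finds a partner away from `w` and `w′`, and
    -- every loop is its own partner.
    star-or-twins : Star ⊎ Twins
    star-or-twins with two? (λ w → R? w w)
    ... | no ¬two = let c , h = at-most-one (λ w → R? w w) ¬two in inj₁ (star-at c h)
    ... | yes (w , w′ , w≢w′ , Rw , Rw′) with two? (λ u → ¬? (R? u u))
    ...   | no ¬two = let c , h = at-most-one (λ u → ¬? (R? u u)) ¬two in
            inj₁ (star-loops c λ z z≢c → decidable-stable (R? z z) (h z z≢c))
    ...   | yes (u , u′ , u≢u′ , ¬Ru , ¬Ru′) = inj₂ (w , w′ , w≢w′ , Rw , Rw′ , free)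
      where
      matched : ∀ z u → z ≢ u → ¬ R z z → ¬ R u u → ∃[ z′ ] (z′ ≢ w × z′ ≢ w′ × R z z′)
      matched z u z≢u ¬Rz ¬Ru = u , (λ { refl → ¬Ru Rw }) , (λ { refl → ¬Ru Rw′ }) ,
        [ id , [ ⊥-elim ∘ ¬Rz , ⊥-elim ∘ ¬Ru ]′ ]′ (R-cover z u z≢u)
      free : Free w w′
      free z z≢w z≢w′ with R? z z
      ... | yes Rz = z , z≢w , z≢w′ , Rz
      ... | no ¬Rz with z Finₚ.≟ u
      ...   | no z≢u   = matched z u z≢u ¬Rz ¬Ru
      ...   | yes refl = matched z u′ u≢u′ ¬Rz ¬Ru′

  -- Bounding the members without a centre

  positionPairs : ∀ k → List (Fin k × Fin k)
  positionPairs k = cartesianProduct (allFin k) (allFin k)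

  module Unstarred {X : Set} (_≟X_ : ∀ (x y : X) → Dec (x ≡ y)) {n k′ : ℕ}
                   (v : X → Fin (2 + k′) → Fin n) (s : ℕ) (E : List X)
                   (v-injective : ∀ {e f} → e ∈ E → f ∈ E → (∀ p → v e p ≡ v f p) → e ≡ f) where

    open Homogeneity _≟X_ v s

    k : ℕ
    k = 2 + k′

    -- Such members differ only at position `b`, where their vertex lies in the blocking set of size
    -- at most `s`.
    agree-one-bound : ∀ {H b e₀} → (∀ {e} → e ∈ H → e ∈ E) → Covered H (b , b) e₀ →
                      AtMost s (λ e → e ∈ H × Agree (b , b) e₀ e)
    agree-one-bound {H} {b} {e₀} H⊆E (Z , Z≤s , all) =
      atMost-mono (λ { {e} (e∈ , e₀~e) → (e∈ , e₀~e) , [ id , id ]′ (All.lookup all e∈ e₀~e) })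
        (≤-trans (≤-reflexive (*-identityʳ ∣ Z ∣)) Z≤s)
        (atMost-valued-in Z (λ e → v e b) (λ e → (e ∈X? H) ×-dec Agree? (b , b) e₀ e)
          (λ z → atMost-1 unique))
      where
      unique : ∀ {z e f} → (e ∈ H × Agree (b , b) e₀ e) × v e b ≡ z →
               (f ∈ H × Agree (b , b) e₀ f) × v f b ≡ z → e ≡ f
      unique {_} {e} {f} ((e∈ , e₀~e) , refl) ((f∈ , e₀~f) , eq) = v-injective (H⊆E e∈) (H⊆E f∈) same
        where
        same : ∀ p → v e p ≡ v f p
        same p with p Finₚ.≟ b
        ... | yes refl = sym eq
        ... | no p≢b   = trans (e₀~e p p≢b p≢b) (sym (e₀~f p p≢b p≢b))

    -- A blocking set `Z` for `{a, b}` forces the vertex at `a` or at `b` into `Z`. Once that vertex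
    -- is fixed, only the other position varies, and `agree-one-bound` leaves `s` members.
    agree-two-bound : ∀ {H a b e₀} → (∀ {e} → e ∈ H → e ∈ E) → Covered H (a , b) e₀ →
                      (∀ {e} → e ∈ H → Covered H (a , a) e) → (∀ {e} → e ∈ H → Covered H (b , b) e) →
                      AtMost (s * s + s * s) (λ e → e ∈ H × Agree (a , b) e₀ e)
    agree-two-bound {H} {a} {b} {e₀} H⊆E (Z , Z≤s , all) cov-a cov-b =
      atMost-⊎ (λ e → Near? e ×-dec (v e a Subₚ.∈? Z))
        (λ { (e∈ , e₀~e) → [ (λ h → inj₁ ((e∈ , e₀~e) , h)) , (λ h → inj₂ ((e∈ , e₀~e) , h)) ]′ (All.lookup all e∈ e₀~e) })
        (half a b id cov-b) (half b a (λ h p p≢a p≢b → h p p≢b p≢a) cov-a)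
      where
      Near : X → Set
      Near e = e ∈ H × Agree (a , b) e₀ e
      Near? : ∀ e → Dec (Near e)
      Near? e = (e ∈X? H) ×-dec Agree? (a , b) e₀ e
      half : ∀ a′ b′ → (∀ {e} → Agree (a , b) e₀ e → Agree (a′ , b′) e₀ e) → (∀ {e} → e ∈ H → Covered H (b′ , b′) e) →
             AtMost (s * s) (λ e → Near e × v e a′ ∈ˢ Z)
      half a′ b′ reorder cov = atMost-mono id (*-monoˡ-≤ s Z≤s)
        (atMost-valued-in Z (λ e → v e a′) Near? λ z → atMost-inhabited λ { {e₁} ((e₁∈ , e₀~e₁) , eq₁) →
          atMost-mono (λ { {e} ((e∈ , e₀~e) , eq) → e∈ , λ p p≢b′ _ → same e₀~e₁ e₀~e (trans eq (sym eq₁)) p p≢b′ }) ≤-refl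
            (agree-one-bound H⊆E (cov e₁∈)) })
        where
        same : ∀ {e₁ e} → Agree (a , b) e₀ e₁ → Agree (a , b) e₀ e → v e a′ ≡ v e₁ a′ → ∀ p → p ≢ b′ → v e p ≡ v e₁ p
        same e₀~e₁ e₀~e eq p p≢b′ with p Finₚ.≟ a′
        ... | yes refl = eq
        ... | no p≢a′  = trans (reorder e₀~e p p≢a′ p≢b′) (sym (reorder e₀~e₁ p p≢a′ p≢b′))

    module _ {a b : Fin k} (a≢b : a ≢ b) where

      others : Fin k′ → Fin k
      others p = punchIn a (punchIn (punchOut a≢b) p)

      others-complete : ∀ p → p ≢ a → p ≢ b → ∃[ q ] (others q ≡ p)
      others-complete p p≢a p≢b = punchOut b′≢p′ ,
        trans (cong (punchIn a) (Finₚ.punchIn-punchOut b′≢p′)) (Finₚ.punchIn-punchOut (p≢a ∘ sym))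
        where
        b′≢p′ : punchOut a≢b ≢ punchOut (p≢a ∘ sym)
        b′≢p′ eq = p≢b (sym (Finₚ.punchOut-injective a≢b (p≢a ∘ sym) eq))

      -- The vertices at the `k′` positions other than `a` and `b`, coded as one number, so that
      -- agreement classes can be enumerated.
      restrict : X → Fin (n ^ k′)
      restrict e = funToFin (v e ∘ others)

      restrict-agree : ∀ {e f} → restrict f ≡ restrict e → Agree (a , b) e f
      restrict-agree {e} {f} eq p p≢a p≢b with q , refl ← others-complete p p≢a p≢b = begin
        v f (others q)              ≡⟨ Finₚ.finToFun-funToFin (v f ∘ others) q ⟨
        finToFun (restrict f) q     ≡⟨ cong (λ r → finToFun r q) eq ⟩
        finToFun (restrict e) q     ≡⟨ Finₚ.finToFun-funToFin (v e ∘ others) q ⟩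
        v e (others q)              ∎
        where open ≡-Reasoning

      -- There are at most `n ^ k′` agreement classes outside `{a, b}`, each of bounded size. This
      -- is the source of the error term of order n^(k-2).
      covered-bound : ∀ {H} → (∀ {e} → e ∈ H → e ∈ E) → (∀ {e} → e ∈ H → Covered H (a , b) e) →
                      (∀ {e} → e ∈ H → Covered H (a , a) e) → (∀ {e} → e ∈ H → Covered H (b , b) e) →
                      AtMost (n ^ k′ * (s * s + s * s)) (_∈ H)
      covered-bound {H} H⊆E cov-ab cov-a cov-b =
        atMost-mono (λ {e} e∈ → restrict e , ∈-allFin _ , e∈ , refl)
          (≤-reflexive (cong (_* (s * s + s * s)) (Listₚ.length-tabulate {n = n ^ k′} id)))
          (atMost-⋃-const (allFin (n ^ k′)) (λ i e → (e ∈X? H) ×-dec (restrict e Finₚ.≟ i)) (s * s + s * s)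
            λ _ → atMost-inhabited λ { {e₀} (e₀∈ , refl) →
              atMost-mono (λ { (e∈ , eq) → e∈ , restrict-agree eq }) ≤-refl
                (agree-two-bound H⊆E (cov-ab e₀∈) cov-a cov-b) })

    -- The graph enters through this property: two vertices of a member are joined when members
    -- through both of them can avoid any small set in all other positions.
    Adjacency : (Fin n → Fin n → Set) → Set
    Adjacency Adj = ∀ {e c y} → e ∈ E → c ≢ y →
      (∀ Z → ∣ Z ∣ ≤ s → ∃[ f ] (f ∈ E × v f c ≡ v e c × v f y ≡ v e y × (∀ z → z ≢ c → z ≢ y → v f z ∉ˢ Z))) →
      Adj (v e c) (v e y)

    module _ (3<k : 3 < k) {Adj : Fin n → Fin n → Set} (adj : Adjacency Adj) {ℓ} (ℓ<s : ℓ < s) (noPath : ¬ Path Adj ℓ) where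

      NoStar : X → Set
      NoStar e = ¬ (∃[ c ] (∀ y → y ≢ c → Adj (v e c) (v e y)))

      module Robust {𝒜 : List Pair} {H : List X} (H⊆E : ∀ {e} → e ∈ H → e ∈ E)
                    (robust : ∀ {I e} → I ∈ 𝒜 → e ∈ H → ¬ Covered H I e)
                    (R-cover : ∀ a b → a ≢ b → (a , b) ∈ 𝒜 ⊎ (a , a) ∈ 𝒜 ⊎ (b , b) ∈ 𝒜) where

        open PositionTypes 3<k (λ a b → (a , b) ∈ 𝒜) (λ a b → Any.any? ((a , b) ≟P_) 𝒜) R-cover

        -- Kernels are closed under intersection: positions are moved off Z one pair after the other.
        refresh : ∀ {e c y} → e ∈ H → Free c y → ∀ Z → ∣ Z ∣ ≤ s → (zs : List (Fin k)) →
          (∀ {z} → z ∈ zs → z ≢ c × z ≢ y) →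
          ∃[ f ] (f ∈ H × v f c ≡ v e c × v f y ≡ v e y × (∀ {z} → z ∈ zs → v f z ∉ˢ Z))
        refresh {e} e∈ free Z Z≤s []       _     = e , e∈ , refl , refl , λ ()
        refresh {e} {c} {y} e∈ free Z Z≤s (z ∷ zs) apart
          with f , f∈ , fc , fy , fzs ← refresh e∈ free Z Z≤s zs (apart ∘ there)
          with z≢c , z≢y ← apart (here refl)
          with z′ , z′≢c , z′≢y , Rzz′ ← free z z≢c z≢y
          with g , g∈ , f~g , ¬hit ← uncovered-escape (robust Rzz′ f∈) Z Z≤s =
          g , g∈ , trans (f~g c (z≢c ∘ sym) (z′≢c ∘ sym)) fc , trans (f~g y (z≢y ∘ sym) (z′≢y ∘ sym)) fy , gzs
          where
          gzs : ∀ {w} → w ∈ z ∷ zs → v g w ∉ˢ Z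
          gzs {w} w∈ gw∈Z with w Finₚ.≟ z | w Finₚ.≟ z′
          ... | yes refl | _        = ¬hit (inj₁ gw∈Z)
          ... | no _     | yes refl = ¬hit (inj₂ gw∈Z)
          ... | no w≢z   | no w≢z′  with w∈
          ...   | here w≡z    = w≢z w≡z
          ...   | there w∈zs  = fzs w∈zs (subst (_∈ˢ Z) (f~g w w≢z w≢z′) gw∈Z)

        free-adjacent : ∀ {e c y} → e ∈ H → c ≢ y → Free c y → Adj (v e c) (v e y)
        free-adjacent {e} {c} {y} e∈ c≢y free = adj (H⊆E e∈) c≢y λ Z Z≤s →
          let f , f∈ , fc , fy , fzs = refresh e∈ free Z Z≤s rest (proj₂ ∘ ∈-filter⁻ rest? {xs = allFin k}) in
          f , H⊆E f∈ , fc , fy , λ z z≢c z≢y → fzs (∈-filter⁺ rest? (∈-allFin z) (z≢c , z≢y))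
          where
          rest? : ∀ z → Dec (z ≢ c × z ≢ y)
          rest? z = ¬? (z Finₚ.≟ c) ×-dec ¬? (z Finₚ.≟ y)
          rest : List (Fin k)
          rest = filter rest? (allFin k)

        -- The path grows at its head, with the roles of `w` and `w′` exchanged at each step. The
        -- head found so far sits at `w′` in a member `e`. Changing only position `w` of `e` gives a
        -- member with the same vertex at `w′` and a vertex at `w` outside the path, and these two
        -- vertices are adjacent.
        alternate : ∀ m → m < s → ∀ {w w′ e₀} → w ≢ w′ → (w , w) ∈ 𝒜 → (w′ , w′) ∈ 𝒜 → Free w w′ → e₀ ∈ H →
                    ∃[ p ] ∃[ e ] (e ∈ H × vertex {Adj = Adj} {ℓ = m} p zero ≡ v e w)
        alternate zero    _   {w} {e₀ = e₀} _ _ _ _ e₀∈ = path-single (v e₀ w) , e₀ , e₀∈ , refl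
        alternate (suc m) m<s {w} {w′} w≢w′ Rw Rw′ free e₀∈
          with p , e , e∈ , head ← alternate m (<⇒≤ m<s) (w≢w′ ∘ sym) Rw′ Rw
                                     (λ z z≢w′ z≢w → let z′ , p , q , r = free z z≢w z≢w′ in z′ , q , p , r) e₀∈
          with f , f∈ , e~f , ¬hit ← uncovered-escape (robust Rw e∈) (image (vertex p)) (≤-trans (∣image∣≤ (vertex p)) (<⇒≤ m<s)) =
          path-cons (v f w) p
            (subst (Adj (v f w)) (trans (e~f w′ (w≢w′ ∘ sym) (w≢w′ ∘ sym)) (sym head)) (free-adjacent f∈ w≢w′ free))
            (λ i eq → ¬hit (inj₁ (subst (_∈ˢ image (vertex p)) (sym eq) (∈-image (vertex p) i)))) ,
          f , f∈ , refl

        -- A common centre position contradicts `NoStar`, and twins contradict `noPath`.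
        empty : (∀ {e} → e ∈ H → NoStar e) → ∀ {e} → ¬ e ∈ H
        empty noStar {e} e∈ with star-or-twins
        ... | inj₁ (c , free) = noStar e∈ (c , λ y y≢c → free-adjacent e∈ (y≢c ∘ sym) (free y y≢c))
        ... | inj₂ (w , w′ , w≢w′ , Rw , Rw′ , free) =
          noPath (proj₁ (alternate ℓ ℓ<s w≢w′ Rw Rw′ free e∈))

      -- Either some `a`, `b` have all three relevant pairs outside `𝒜`, and `covered-bound` counts
      -- the family, or the hypothesis of the dichotomy for positions holds and the family is empty.
      robust-bound : RobustBound (λ e → e ∈ E × NoStar e) (n ^ k′ * (s * s + s * s))
      robust-bound 𝒜 H QH robust dead
        with Finₚ.any? (λ a → Finₚ.any? λ b → ¬? (a Finₚ.≟ b) ×-dec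
               ¬? (in𝒜? a b) ×-dec ¬? (in𝒜? a a) ×-dec ¬? (in𝒜? b b))
        where
        in𝒜? : ∀ a b → Dec ((a , b) ∈ 𝒜)
        in𝒜? a b = Any.any? ((a , b) ≟P_) 𝒜
      ... | yes (a , b , a≢b , ab∉ , aa∉ , bb∉) =
        covered-bound a≢b (proj₁ ∘ QH) (dead ab∉) (dead aa∉) (dead bb∉)
      ... | no ¬p = atMost-mono id z≤n (atMost-0 (Robust.empty (proj₁ ∘ QH) robust cover (proj₂ ∘ QH)))
        where
        cover : ∀ a b → a ≢ b → (a , b) ∈ 𝒜 ⊎ (a , a) ∈ 𝒜 ⊎ (b , b) ∈ 𝒜
        cover a b a≢b with Any.any? ((a , b) ≟P_) 𝒜 | Any.any? ((a , a) ≟P_) 𝒜 | Any.any? ((b , b) ≟P_) 𝒜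
        ... | yes p | _     | _     = inj₁ p
        ... | no _  | yes p | _     = inj₂ (inj₁ p)
        ... | no _  | no _  | yes p = inj₂ (inj₂ p)
        ... | no p  | no q  | no r  = ⊥-elim (¬p (a , b , a≢b , p , q , r))

      noStar-bound : AtMost (boundFactor (length (positionPairs k)) * (n ^ k′ * (s * s + s * s))) (λ e → e ∈ E × NoStar e)
      noStar-bound L u all =
        homogeneous-bound robust-bound (length (positionPairs k)) (positionPairs k) L ≤-refl
          -- The recursion starts with all pairs in `𝒜`, so no pair has to be covered yet.
          (All.lookup all) (λ I∉ _ → ⊥-elim (I∉ (∈-cartesianProduct⁺ (∈-allFin _) (∈-allFin _)))) L u (All.tabulate id)

  -- Removing an element, and addressing elements of a set by position

  ∣p-x∣ : ∀ {n} {p : Subset n} {x} → x ∈ˢ p → suc ∣ p -ˢ x ∣ ≡ ∣ p ∣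
  ∣p-x∣ {p = inside  ∷ p} here       = cong (suc ∘ ∣_∣) (Subₚ.p─⊥≡p p)
  ∣p-x∣ {p = inside  ∷ p} (there x∈) = cong suc (∣p-x∣ x∈)
  ∣p-x∣ {p = outside ∷ p} (there x∈) = ∣p-x∣ x∈

  x∉p-x : ∀ {n} (p : Subset n) {x} → x ∉ˢ p -ˢ x
  x∉p-x (_ ∷ p) {zero}  ()
  x∉p-x (_ ∷ p) {suc x} (there x∈) = x∉p-x p x∈

  -ˢ-injective : ∀ {n} {A B : Subset n} {c} → c ∈ˢ A → c ∈ˢ B → A -ˢ c ≡ B -ˢ c → A ≡ B
  -ˢ-injective {n} c∈A c∈B eq = Subₚ.⊆-antisym (half c∈B eq) (half c∈A (sym eq))
    where
    half : ∀ {A B : Subset n} {c} → c ∈ˢ B → A -ˢ c ≡ B -ˢ c → A ⊆ˢ B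
    half {A} {B} {c} c∈B eq {y} y∈A with y Finₚ.≟ c
    ... | yes refl = c∈B
    ... | no y≢c   = Subₚ.p─q⊆p B ⁅ c ⁆ (subst (y ∈ˢ_) eq (Subₚ.x∈p∧x≢y⇒x∈p-y y∈A y≢c))

  -- The value x₀ at positions beyond the size of A is junk.
  elementAt : ∀ {n} → Fin n → ∀ k → Subset n → Fin k → Fin n
  elementAt x₀ k A p with toℕ p <? ∣ A ∣
  ... | yes p<∣A∣ = Vec.lookup (elements A) (fromℕ< p<∣A∣)
  ... | no  _     = x₀

  elementAt-lookup : ∀ {n} (x₀ : Fin n) (A : Subset n) p → elementAt x₀ ∣ A ∣ A p ≡ Vec.lookup (elements A) p
  elementAt-lookup x₀ A p with toℕ p <? ∣ A ∣
  ... | yes p<∣A∣ = cong (Vec.lookup (elements A)) (Finₚ.fromℕ<-toℕ p p<∣A∣)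
  ... | no  p≮∣A∣ = ⊥-elim (p≮∣A∣ (Finₚ.toℕ<n p))

  elementAt-sound : ∀ {n} (x₀ : Fin n) {k} (A : Subset n) → ∣ A ∣ ≡ k → ∀ p → elementAt x₀ k A p ∈ˢ A
  elementAt-sound x₀ A refl p = subst (_∈ˢ A) (sym (elementAt-lookup x₀ A p)) (elements-sound A p)

  elementAt-complete : ∀ {n} (x₀ : Fin n) {k} (A : Subset n) → ∣ A ∣ ≡ k → ∀ {x} → x ∈ˢ A → ∃[ p ] (elementAt x₀ k A p ≡ x)
  elementAt-complete x₀ A refl x∈ = let p , eq = elements-complete A x∈ in p , trans (elementAt-lookup x₀ A p) eq

  elementAt-injective : ∀ {n} (x₀ : Fin n) {k} (A : Subset n) → ∣ A ∣ ≡ k → ∀ {p q} → elementAt x₀ k A p ≡ elementAt x₀ k A q → p ≡ q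
  elementAt-injective x₀ A refl {p} {q} eq =
    elements-injective A (trans (sym (elementAt-lookup x₀ A p)) (trans eq (elementAt-lookup x₀ A q)))

  fromDec : ∀ {n} {P : Fin n → Set} → Decidable P → Subset n
  fromDec P? = Vec.tabulate (does ∘ P?)

  ∈-fromDec⁺ : ∀ {n} {P : Fin n → Set} (P? : Decidable P) {x} → P x → x ∈ˢ fromDec P?
  ∈-fromDec⁺ P? {x} px = Vecₚ.lookup⇒[]= x _ (trans (Vecₚ.lookup∘tabulate (does ∘ P?) x) (isTrue (P? x)))
    where
    isTrue : (d : Dec _) → does d ≡ true
    isTrue (yes _)  = refl
    isTrue (no ¬px) = ⊥-elim (¬px px)

  ∈-fromDec⁻ : ∀ {n} {P : Fin n → Set} (P? : Decidable P) {x} → x ∈ˢ fromDec P? → P x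
  ∈-fromDec⁻ P? {x} x∈ = fromTrue (P? x) (trans (sym (Vecₚ.lookup∘tabulate (does ∘ P?) x)) (Vecₚ.[]=⇒lookup x∈))
    where
    fromTrue : (d : Dec _) → does d ≡ true → _
    fromTrue (yes px) _ = px

  ∣∣≤length : ∀ {n} (A : Subset n) (L : List (Fin n)) → (∀ {x} → x ∈ˢ A → x ∈ L) → ∣ A ∣ ≤ length L
  ∣∣≤length A L A⊆L = subst (_≤ length L) (Listₚ.length-tabulate (Vec.lookup (elements A)))
    (atMost-∈ Finₚ._≟_ L (elementList A) (Uniqueₚ.tabulate⁺ (elements-injective A))
      (All.tabulate λ x∈ → let i , eq = ∈-tabulate⁻ x∈ in A⊆L (subst (_∈ˢ A) (sym eq) (elements-sound A i))))

  -- The kernel graph and the expansion of its paths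

  module KernelGraph {n : ℕ} (E : List (Subset n)) (s : ℕ) where

    Joins : Fin n → Fin n → Subset n → Subset n → Set
    Joins x y Z A = x ∈ˢ A × y ∈ˢ A × (∀ z → z ∈ˢ A → z ∈ˢ Z → z ≡ x ⊎ z ≡ y)

    Joins? : ∀ x y Z A → Dec (Joins x y Z A)
    Joins? x y Z A = (x Subₚ.∈? A) ×-dec (y Subₚ.∈? A) ×-dec
      Finₚ.all? λ z → (z Subₚ.∈? A) →-dec (z Subₚ.∈? Z) →-dec ((z Finₚ.≟ x) ⊎-dec (z Finₚ.≟ y))

    -- x and y are adjacent when {x, y} is the kernel of large sunflowers in E.
    Adj : Fin n → Fin n → Set
    Adj x y = x ≢ y × ¬ (∃[ Z ] (∣ Z ∣ ≤ s × ¬ Any (Joins x y Z) E))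

    Adj? : ∀ x y → Dec (Adj x y)
    Adj? x y = ¬? (x Finₚ.≟ y) ×-dec
      ¬? (Subₚ.anySubset? λ Z → (∣ Z ∣ ≤? s) ×-dec ¬? (Any.any? (Joins? x y Z) E))

    adj-sym : ∀ {x y} → Adj x y → Adj y x
    adj-sym (x≢y , h) = x≢y ∘ sym , λ { (Z , Z≤s , ¬any) → h (Z , Z≤s , λ any → ¬any
      (Any.map (λ { (x∈ , y∈ , only) → y∈ , x∈ , λ z z∈A z∈Z → [ inj₂ , inj₁ ]′ (only z z∈A z∈Z) }) any)) }

    adj-edge : ∀ {x y} → Adj x y → ∀ Z → ∣ Z ∣ ≤ s → ∃[ A ] (A ∈ E × Joins x y Z A)
    adj-edge {x} {y} (_ , h) Z Z≤s =
      find (decidable-stable (Any.any? (Joins? x y Z) E) λ ¬any → h (Z , Z≤s , ¬any))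

    -- `V` is meant to hold the vertices of the whole path and `U` the union of the edges already
    -- chosen. An edge may meet either set only in its own two path vertices.
    record Expansion {ℓ : ℕ} (x : Fin (suc ℓ) → Fin n) (V U : Subset n) : Set where
      field
        edge     : Fin ℓ → Subset n
        edge∈    : ∀ i → edge i ∈ E
        left∈    : ∀ i → x (inject₁ i) ∈ˢ edge i
        right∈   : ∀ i → x (suc i) ∈ˢ edge i
        meets-VU : ∀ i {z} → z ∈ˢ edge i → z ∈ˢ V ⊎ z ∈ˢ U → z ≡ x (inject₁ i) ⊎ z ≡ x (suc i)
        meets    : ∀ i j → toℕ i < toℕ j → ∀ {z} → z ∈ˢ edge i → z ∈ˢ edge j → z ≡ x (inject₁ j) ⊎ z ≡ x (suc j)

    open Expansion

    -- Every new edge avoids V and, through U, all the edges chosen before.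
    expand : ∀ {k} → (∀ {A} → A ∈ E → ∣ A ∣ ≡ k) → ∀ {ℓ} (x : Fin (suc ℓ) → Fin n) (V U : Subset n) →
             (∀ i → Adj (x (inject₁ i)) (x (suc i))) → ∣ V ∣ + ∣ U ∣ + ℓ * k ≤ s → Expansion x V U
    expand uniform {zero}  x V U adj size≤s = record
      { edge = λ () ; edge∈ = λ () ; left∈ = λ () ; right∈ = λ () ; meets-VU = λ () ; meets = λ () }
    expand {k} uniform {suc ℓ} x V U adj size≤s
      with A , A∈E , x₀∈A , x₁∈A , only ← adj-edge (adj zero) (V ∪ U)
             (≤-trans (∣p∪q∣≤∣p∣+∣q∣ V U) (m+n≤o⇒m≤o _ size≤s)) = result
      where
      rest : Expansion (x ∘ suc) V (A ∪ U)
      rest = expand uniform (x ∘ suc) V (A ∪ U) (adj ∘ suc) (≤-trans (begin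
        ∣ V ∣ + ∣ A ∪ U ∣ + ℓ * k         ≤⟨ +-monoˡ-≤ (ℓ * k) (+-monoʳ-≤ ∣ V ∣ (∣p∪q∣≤∣p∣+∣q∣ A U)) ⟩
        ∣ V ∣ + (∣ A ∣ + ∣ U ∣) + ℓ * k   ≡⟨ cong (λ a → ∣ V ∣ + (a + ∣ U ∣) + ℓ * k) (uniform A∈E) ⟩
        ∣ V ∣ + (k + ∣ U ∣) + ℓ * k       ≡⟨ cong (λ a → ∣ V ∣ + a + ℓ * k) (+-comm k ∣ U ∣) ⟩
        ∣ V ∣ + (∣ U ∣ + k) + ℓ * k       ≡⟨ cong (_+ ℓ * k) (+-assoc ∣ V ∣ ∣ U ∣ k) ⟨
        ∣ V ∣ + ∣ U ∣ + k + ℓ * k         ≡⟨ +-assoc (∣ V ∣ + ∣ U ∣) k (ℓ * k) ⟩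
        ∣ V ∣ + ∣ U ∣ + (k + ℓ * k)       ∎) size≤s)
        where open ≤-Reasoning
      result : Expansion x V U
      result .edge zero        = A
      result .edge (suc i)     = edge rest i
      result .edge∈ zero       = A∈E
      result .edge∈ (suc i)    = edge∈ rest i
      result .left∈ zero       = x₀∈A
      result .left∈ (suc i)    = left∈ rest i
      result .right∈ zero      = x₁∈A
      result .right∈ (suc i)   = right∈ rest i
      result .meets-VU zero    z∈A = only _ z∈A ∘ [ Subₚ.p⊆p∪q U , Subₚ.q⊆p∪q V U ]′
      result .meets-VU (suc i) z∈  = meets-VU rest i z∈ ∘ [ inj₁ , inj₂ ∘ Subₚ.q⊆p∪q A U ]′
      result .meets zero    (suc j) _         z∈A z∈ = meets-VU rest j z∈ (inj₂ (Subₚ.p⊆p∪q U z∈A))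
      result .meets (suc i) (suc j) (s≤s i<j) z∈  z∈′ = meets rest i j i<j z∈ z∈′

    -- The bound on `s` leaves room for the `suc ℓ` path vertices and for `ℓ` edges of size `k`, all
    -- of which may have to be avoided. Since `k` exceeds 1, two edges sharing at most one vertex
    -- are distinct.
    path-expansion : ∀ {k} → 1 < k → (∀ {A} → A ∈ E → ∣ A ∣ ≡ k) → ∀ {ℓ} → suc ℓ + ℓ * k ≤ s → Path Adj ℓ →
                     ∃[ P ] (IsLinearPath {n} ℓ P × (∀ i → P i ∈ E))
    path-expansion {k} 1<k uniform {ℓ} bound p = edge X , ((injective-P , one , none) , edge∈ X)
      where
      x = vertex p
      V = image x
      X : Expansion x V Sub.⊥
      X = expand uniform x V Sub.⊥ (adjacent p) (≤-trans
        (+-monoˡ-≤ (ℓ * k) (≤-trans (≤-reflexive (trans (cong (∣ V ∣ +_) (Subₚ.∣⊥∣≡0 n)) (+-identityʳ _))) (∣image∣≤ x))) bound)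
      end∈V : ∀ j {z} → z ≡ x (inject₁ j) ⊎ z ≡ x (suc j) → z ∈ˢ V
      end∈V j (inj₁ refl) = ∈-image x _
      end∈V j (inj₂ refl) = ∈-image x _
      index : ∀ {a b z} → z ≡ x a → z ≡ x b → toℕ a ≡ toℕ b
      index za zb = cong toℕ (injective p (trans (sym za) zb))
      -- A shared vertex is an end of the later edge, hence a path vertex, hence also an end of the
      -- earlier edge. Injectivity of the path leaves only the joint of consecutive edges.
      common : ∀ i j → toℕ i < toℕ j → ∀ {z} → z ∈ˢ edge X i → z ∈ˢ edge X j → z ≡ x (suc i) × toℕ j ≡ suc (toℕ i)
      common i j i<j {z} z∈i z∈j with meets X i j i<j z∈i z∈j
      ... | zj with meets-VU X i z∈i (inj₁ (end∈V j zj)) | zj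
      ...   | inj₁ zi | inj₁ zj′ = ⊥-elim (<⇒≢ i<j (trans (sym (Finₚ.toℕ-inject₁ i)) (trans (index zi zj′) (Finₚ.toℕ-inject₁ j))))
      ...   | inj₁ zi | inj₂ zj′ = ⊥-elim (<⇒≢ (m<n⇒m<1+n i<j) (trans (sym (Finₚ.toℕ-inject₁ i)) (index zi zj′)))
      ...   | inj₂ zi | inj₁ zj′ = zi , trans (sym (Finₚ.toℕ-inject₁ j)) (index zj′ zi)
      ...   | inj₂ zi | inj₂ zj′ = ⊥-elim (<⇒≢ i<j (suc-injective (index zi zj′)))
      one : ∀ i j → toℕ j ≡ suc (toℕ i) → ∣ edge X i ∩ edge X j ∣ ≡ 1
      one i j j≡1+i = trans (cong ∣_∣ (Subₚ.⊆-antisym ⊆₁ ⊆₂)) (Subₚ.∣⁅x⁆∣≡1 (x (suc i)))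
        where
        ⊆₁ : (edge X i ∩ edge X j) ⊆ˢ ⁅ x (suc i) ⁆
        ⊆₁ z∈ with z∈i , z∈j ← Subₚ.x∈p∩q⁻ _ _ z∈
          with refl , _ ← common i j (≤-reflexive (sym j≡1+i)) z∈i z∈j = Subₚ.x∈⁅x⁆ _
        ⊆₂ : ⁅ x (suc i) ⁆ ⊆ˢ (edge X i ∩ edge X j)
        ⊆₂ z∈ with refl ← Subₚ.x∈⁅y⁆⇒x≡y _ z∈ = Subₚ.x∈p∩q⁺ (right∈ X i ,
          subst (λ a → x a ∈ˢ edge X j) (Finₚ.toℕ-injective (trans (Finₚ.toℕ-inject₁ j) j≡1+i)) (left∈ X j))
      none : ∀ i j → suc (toℕ i) < toℕ j → ∣ edge X i ∩ edge X j ∣ ≡ 0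
      none i j 1+i<j = trans (cong ∣_∣ (Subₚ.Empty-unique λ { (z , z∈) →
        let z∈i , z∈j = Subₚ.x∈p∩q⁻ _ _ z∈
            _ , j≡1+i = common i j (<⇒≤ 1+i<j) z∈i z∈j
        in <⇒≢ 1+i<j (sym j≡1+i) })) (Subₚ.∣⊥∣≡0 n)
      distinct-edges : ∀ i j → toℕ i < toℕ j → edge X i ≢ edge X j
      distinct-edges i j i<j eq = <⇒≱ 1<k (begin
        k                         ≡⟨ uniform (edge∈ X i) ⟨
        ∣ edge X i ∣              ≤⟨ Subₚ.p⊆q⇒∣p∣≤∣q∣ inside-singleton ⟩
        ∣ ⁅ x (suc i) ⁆ ∣         ≡⟨ Subₚ.∣⁅x⁆∣≡1 (x (suc i)) ⟩
        1                         ∎)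
        where
        open ≤-Reasoning
        inside-singleton : edge X i ⊆ˢ ⁅ x (suc i) ⁆
        inside-singleton z∈ with refl , _ ← common i j i<j z∈ (subst (_ ∈ˢ_) eq z∈) = Subₚ.x∈⁅x⁆ _
      injective-P : ∀ {i j} → edge X i ≡ edge X j → i ≡ j
      injective-P {i} {j} eq with Finₚ.<-cmp i j
      ... | tri< i<j _ _ = ⊥-elim (distinct-edges i j i<j eq)
      ... | tri≈ _ i≡j _ = i≡j
      ... | tri> _ _ j<i = ⊥-elim (distinct-edges j i j<i (sym eq))

    CentredAt : Fin n → Subset n → Set
    CentredAt c A = c ∈ˢ A × (∀ y → y ∈ˢ A → y ≢ c → Adj c y)

    CentredAt? : ∀ c A → Dec (CentredAt c A)
    CentredAt? c A = (c Subₚ.∈? A) ×-dec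
      Finₚ.all? λ y → (y Subₚ.∈? A) →-dec ¬? (y Finₚ.≟ c) →-dec Adj? c y

    neighbours : Fin n → List (Fin n)
    neighbours c = filter (Adj? c) (allFin n)

    ∣fromDec∣≤ : ∀ c → ∣ fromDec (Adj? c) ∣ ≤ length (neighbours c)
    ∣fromDec∣≤ c = ∣∣≤length (fromDec (Adj? c)) (neighbours c)
      λ {x} x∈ → ∈-filter⁺ (Adj? c) (∈-allFin x) (∈-fromDec⁻ (Adj? c) x∈)

    -- Deleting the centre maps these members injectively to `j`-element subsets of the
    -- neighbourhood of `c`.
    centredAt-bound : ∀ {j} → (∀ {A} → A ∈ E → ∣ A ∣ ≡ suc j) → ∀ c →
                      AtMost (∣ fromDec (Adj? c) ∣ C j) (λ A → A ∈ E × CentredAt c A)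
    centredAt-bound {j} uniform c = atMost-inj {Q = λ A → A ⊆ˢ fromDec (Adj? c) × ∣ A ∣ ≡ j} (_-ˢ c)
      (λ (_ , c∈A , _) (_ , c∈B , _) → -ˢ-injective c∈A c∈B)
      (λ { {A} (A∈ , c∈A , adj) →
        (λ {y} y∈ → ∈-fromDec⁺ (Adj? c) (adj y (Subₚ.p─q⊆p A ⁅ c ⁆ y∈) (λ { refl → x∉p-x A y∈ }))) ,
        suc-injective (trans (∣p-x∣ c∈A) (uniform A∈)) })
      (atMost-subsets (fromDec (Adj? c)) j)

  -- Counting a uniform family through its centres

  module _ {n k′ : ℕ} (x₀ : Fin n) (E : List (Subset n)) (s : ℕ) (uniform : ∀ {A} → A ∈ E → ∣ A ∣ ≡ 2 + k′) where

    open KernelGraph E s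

    private
      k : ℕ
      k = 2 + k′

    -- The instance of `noStar-bound` in which positions number the elements of a member in
    -- increasing order, with centre positions translated into centre vertices.
    uncentred-bound : 3 < k → ∀ {ℓ} → ℓ < s → ¬ Path Adj ℓ →
                      AtMost (boundFactor (length (positionPairs k)) * (n ^ k′ * (s * s + s * s)))
                             (λ A → A ∈ E × ¬ (∃[ c ] CentredAt c A))
    uncentred-bound 3<k ℓ<s noPath =
      atMost-mono (λ { {A} (A∈ , ¬centred) → A∈ , λ { (c , adj) → ¬centred (elementAt x₀ k A c , elementAt-sound x₀ A (uniform A∈) c ,
          λ y y∈ y≢c → let q , eq = elementAt-complete x₀ A (uniform A∈) y∈ in
            subst (Adj _) eq (adj q λ { refl → y≢c (sym eq) })) } }) ≤-refl
        (Unstarred.noStar-bound (Vecₚ.≡-dec Boolₚ._≟_) (elementAt x₀ k) s E elementAt-determines 3<k adjacency ℓ<s noPath)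
      where
      elementAt-determines : ∀ {A B} → A ∈ E → B ∈ E → (∀ p → elementAt x₀ k A p ≡ elementAt x₀ k B p) → A ≡ B
      elementAt-determines A∈ B∈ same = Subₚ.⊆-antisym (half A∈ B∈ same) (half B∈ A∈ (sym ∘ same))
        where
        half : ∀ {A B} → A ∈ E → B ∈ E → (∀ p → elementAt x₀ k A p ≡ elementAt x₀ k B p) → A ⊆ˢ B
        half {A} {B} A∈ B∈ same x∈ with p , refl ← elementAt-complete x₀ A (uniform A∈) x∈ =
          subst (_∈ˢ B) (sym (same p)) (elementAt-sound x₀ B (uniform B∈) p)
      adjacency : Unstarred.Adjacency (Vecₚ.≡-dec Boolₚ._≟_) (elementAt x₀ k) s E elementAt-determines Adj
      adjacency {e} {c} {y} e∈ c≢y kernel = c≢y ∘ elementAt-injective x₀ e (uniform e∈) , λ { (Z , Z≤s , ¬any) →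
        let f , f∈ , fc , fy , avoids = kernel Z Z≤s in
        ¬any (lose f∈ (subst (_∈ˢ f) fc (elementAt-sound x₀ f (uniform f∈) c) ,
                       subst (_∈ˢ f) fy (elementAt-sound x₀ f (uniform f∈) y) ,
                       λ z z∈f z∈Z → only f f∈ fc fy avoids z∈f z∈Z)) }
        where
        only : ∀ f → f ∈ E → elementAt x₀ k f c ≡ elementAt x₀ k e c → elementAt x₀ k f y ≡ elementAt x₀ k e y → ∀ {Z} →
               (∀ z → z ≢ c → z ≢ y → elementAt x₀ k f z ∉ˢ Z) → ∀ {z} → z ∈ˢ f → z ∈ˢ Z →
               z ≡ elementAt x₀ k e c ⊎ z ≡ elementAt x₀ k e y
        only f f∈ fc fy avoids z∈f z∈Z with q , refl ← elementAt-complete x₀ f (uniform f∈) z∈f with q Finₚ.≟ c | q Finₚ.≟ y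
        ... | yes refl | _        = inj₁ fc
        ... | no _     | yes refl = inj₂ fy
        ... | no q≢c   | no q≢y   = ⊥-elim (avoids q q≢c q≢y z∈Z)

    -- If all vertices of a member satisfy `Q`, so does its centre. A trivial `Q` serves to count
    -- the whole family, and small degree as `Q` serves to count the members that miss `S`.
    centred-count : 3 < k → ∀ {ℓ} → ℓ < s → ¬ Path Adj ℓ → {Q : Fin n → Set} (Q? : Decidable Q) →
      AtMost (boundFactor (length (positionPairs k)) * (n ^ k′ * (s * s + s * s))
               + ∑ (allFin n) (λ c → ⟦ Q? c ⟧ * (∣ fromDec (Adj? c) ∣ C suc k′)))
             (λ A → A ∈ E × (∀ {c} → c ∈ˢ A → Q c))
    centred-count 3<k ℓ<s noPath {Q} Q? = atMost-⊎ (λ A → Any.any? (Vecₚ.≡-dec Boolₚ._≟_ A) E ×-dec ¬? (Finₚ.any? λ c → CentredAt? c A))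
      split (uncentred-bound 3<k ℓ<s noPath)
      (atMost-⋃ (allFin n) (λ c A → Any.any? (Vecₚ.≡-dec Boolₚ._≟_ A) E ×-dec CentredAt? c A ×-dec Q? c)
        (λ c → ⟦ Q? c ⟧ * (∣ fromDec (Adj? c) ∣ C suc k′)) (λ {c} _ → at c))
      where
      split : ∀ {A} → A ∈ E × (∀ {c} → c ∈ˢ A → Q c) →
              (A ∈ E × ¬ (∃[ c ] CentredAt c A)) ⊎ ∃[ c ] (c ∈ allFin n × A ∈ E × CentredAt c A × Q c)
      split {A} (A∈ , all-Q) with Finₚ.any? (λ c → CentredAt? c A)
      ... | yes (c , centred) = inj₂ (c , ∈-allFin c , A∈ , centred , all-Q (proj₁ centred))
      ... | no ¬centred       = inj₁ (A∈ , ¬centred)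
      at : ∀ c → AtMost (⟦ Q? c ⟧ * (∣ fromDec (Adj? c) ∣ C suc k′)) (λ A → A ∈ E × CentredAt c A × Q c)
      at c with Q? c
      ... | yes _  = atMost-mono (λ (A∈ , centred , _) → A∈ , centred) (≤-reflexive (sym (+-identityʳ _))) (centredAt-bound uniform c)
      ... | no ¬Qc = atMost-0 λ (_ , _ , Qc) → ¬Qc Qc

  -- Degree sums in graphs without long paths

  length-allFin : ∀ n → length (allFin n) ≡ n
  length-allFin n = Listₚ.length-tabulate {n = n} id

  ∑-remove : ∀ {n} (V : List (Fin n)) → Unique V → ∀ {v} → v ∈ V → (f : Fin n → ℕ) →
             ∑ V f ≤ f v + ∑ (filter (λ x → ¬? (x Finₚ.≟ v)) V) f
  ∑-remove (x ∷ V) (x∉V ∷ u) {v} v∈ f with x Finₚ.≟ v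
  ... | yes refl = ≤-reflexive (trans (∑-∷ x V) (cong (λ W → f x + ∑ W f)
        (sym (Listₚ.filter-all (λ y → ¬? (y Finₚ.≟ x)) (All.map (_∘ sym) x∉V)))))
  ... | no x≢v with v∈
  ...   | here v≡x  = ⊥-elim (x≢v (sym v≡x))
  ...   | there v∈V = begin
          ∑ (x ∷ V) f               ≡⟨ ∑-∷ x V ⟩
          f x + ∑ V f               ≤⟨ +-monoʳ-≤ (f x) (∑-remove V u v∈V f) ⟩
          f x + (f v + ∑ V′ f)      ≡⟨ x+[y+z]≡y+[x+z] (f x) (f v) (∑ V′ f) ⟩
          f v + (f x + ∑ V′ f)      ≡⟨ cong (f v +_) (∑-∷ x V′) ⟨
          f v + ∑ (x ∷ V′) f        ∎
    where
    open ≤-Reasoning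
    V′ = filter (λ x → ¬? (x Finₚ.≟ v)) V
    x+[y+z]≡y+[x+z] : ∀ a b c → a + (b + c) ≡ b + (a + c)
    x+[y+z]≡y+[x+z] = solve-∀

  -- Room for `suc t` hubs and for the `suc (suc t * 2)` vertices of a path with `suc t * 2` edges.
  hubFactor : ℕ → ℕ
  hubFactor t = suc t + suc (suc t * 2)

  module PathFree {n : ℕ} {Adj : Fin n → Fin n → Set} (Adj? : ∀ x y → Dec (Adj x y))
                  (adj-sym : ∀ {x y} → Adj x y → Adj y x) where

    ⟦Adj⟧ : Fin n → Fin n → ℕ
    ⟦Adj⟧ x y = ⟦ Adj? x y ⟧

    ⟦Adj⟧-sym : ∀ x y → ⟦Adj⟧ x y ≡ ⟦Adj⟧ y x
    ⟦Adj⟧-sym x y with Adj? x y | Adj? y x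
    ... | yes _ | yes _ = refl
    ... | no  _ | no  _ = refl
    ... | yes p | no ¬q = ⊥-elim (¬q (adj-sym p))
    ... | no ¬p | yes q = ⊥-elim (¬p (adj-sym q))

    degree : Fin n → ℕ
    degree x = ∑ (allFin n) (⟦Adj⟧ x)

    degree≤n : ∀ x → degree x ≤ n
    degree≤n x = ≤-trans (≤-reflexive (∑-⟦⟧ (Adj? x) (allFin n)))
      (≤-trans (Listₚ.length-filter (Adj? x) (allFin n)) (≤-reflexive (length-allFin n)))

    -- Greedy extension: the head always has more neighbours in `V` than the path has vertices.
    min-degree-path : ∀ {V v m} → Unique V → v ∈ V → (∀ {u} → u ∈ V → m ≤ length (filter (Adj? u) V)) →
                      ∀ ℓ → ℓ < m → ∃[ p ] (∀ i → vertex {Adj = Adj} {ℓ = ℓ} p i ∈ V)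
    min-degree-path {v = v} u v∈ deg zero    ℓ<m = path-single v , λ _ → v∈
    min-degree-path {V} {m = m} u v∈ deg (suc ℓ) ℓ<m
      with p , p⊆V ← min-degree-path u v∈ deg ℓ (<⇒≤ ℓ<m)
      with w , w∈N , w∉p ← pick-fresh (Uniqueₚ.filter⁺ (Adj? (vertex p zero)) u) (List.tabulate (vertex p))
             (<-≤-trans (subst (_< m) (sym (Listₚ.length-tabulate (vertex p))) ℓ<m) (deg (p⊆V zero)))
      with w∈V , adj ← ∈-filter⁻ (Adj? (vertex p zero)) {xs = V} w∈N =
      path-cons w p (adj-sym adj) (λ i eq → w∉p (subst (_∈ List.tabulate (vertex p)) (sym eq) (∈-tabulate⁺ {f = vertex p} i))) ,
      λ { zero → w∈V ; (suc i) → p⊆V i }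

    module _ {ℓ} (noPath : ¬ Path Adj ℓ) where

      -- Degeneracy: without a path of length `ℓ` some vertex has degree below `suc ℓ` inside `V`.
      -- It is deleted and the argument repeated. The double sum counts ordered pairs, so each
      -- deletion costs twice the degree.
      edges≤ : ∀ l V → length V ≤ l → Unique V → ∑ V (λ x → ∑ V (⟦Adj⟧ x)) ≤ l * (2 * suc ℓ)
      edges≤ l [] _ _ = ≤-trans (≤-reflexive (∑-[] {f = λ x → ∑ [] (⟦Adj⟧ x)})) z≤n
      edges≤ (suc l) V@(v₀ ∷ _) V≤l u with Any.any? (λ v → length (filter (Adj? v) V) <? suc ℓ) V
      ... | no ¬low = ⊥-elim (noPath (proj₁ (min-degree-path u (here refl) (λ u∈ → ≮⇒≥ (¬low ∘ lose u∈)) ℓ ≤-refl)))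
      ... | yes low with v , v∈ , dv<1+ℓ ← find low = begin
        ∑ V (λ x → ∑ V (⟦Adj⟧ x))                              ≤⟨ ∑-remove V u v∈ (λ x → ∑ V (⟦Adj⟧ x)) ⟩
        dv + ∑ W (λ x → ∑ V (⟦Adj⟧ x))                         ≤⟨ +-monoʳ-≤ dv (∑-mono W λ {x} _ → ∑-remove V u v∈ (⟦Adj⟧ x)) ⟩
        dv + ∑ W (λ x → ⟦Adj⟧ x v + ∑ W (⟦Adj⟧ x))             ≡⟨ cong (dv +_) (∑-+ W (λ x → ⟦Adj⟧ x v) (λ x → ∑ W (⟦Adj⟧ x))) ⟩
        dv + (∑ W (λ x → ⟦Adj⟧ x v) + ∑ W (λ x → ∑ W (⟦Adj⟧ x))) ≤⟨ +-monoʳ-≤ dv (+-mono-≤ into-v (edges≤ l W W≤l (Uniqueₚ.filter⁺ (λ x → ¬? (x Finₚ.≟ v)) u))) ⟩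
        dv + (dv + l * (2 * suc ℓ))                            ≤⟨ +-mono-≤ dv≤ (+-monoˡ-≤ _ dv≤) ⟩
        suc ℓ + (suc ℓ + l * (2 * suc ℓ))                      ≡⟨ rearrange (suc ℓ) (l * (2 * suc ℓ)) ⟩
        suc l * (2 * suc ℓ)                                    ∎
        where
        open ≤-Reasoning
        W = filter (λ x → ¬? (x Finₚ.≟ v)) V
        dv = ∑ V (⟦Adj⟧ v)
        dv≤ : dv ≤ suc ℓ
        dv≤ = ≤-trans (≤-reflexive (∑-⟦⟧ (Adj? v) V)) (<⇒≤ dv<1+ℓ)
        into-v : ∑ W (λ x → ⟦Adj⟧ x v) ≤ dv
        into-v = ≤-trans (∑-mono W (λ {x} _ → ≤-reflexive (⟦Adj⟧-sym x v))) (∑-filter-≤ (λ x → ¬? (x Finₚ.≟ v)) V (⟦Adj⟧ v))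
        W≤l : length W ≤ l
        W≤l = ≤-pred (≤-trans (Listₚ.filter-notAll (λ x → ¬? (x Finₚ.≟ v)) V (Any.map (λ { refl h → h refl }) v∈)) V≤l)
        rearrange : ∀ a b → a + (a + b) ≡ 2 * a + b
        rearrange = solve-∀

      degree-sum≤ : ∑ (allFin n) degree ≤ n * (2 * suc ℓ)
      degree-sum≤ = edges≤ n (allFin n) (≤-reflexive (length-allFin n)) (Uniqueₚ.allFin⁺ n)

    -- Vertices of `Y` alternate with the elements of `hs`. The invariant that every path vertex
    -- lies in `hs` or outside `T` guarantees that the next element of `T` is new, and the size of
    -- `Y` guarantees a new vertex of `Y`.
    alternating-path : ∀ {T Y : List (Fin n)} → Unique Y → (∀ {y h} → y ∈ Y → h ∈ T → Adj y h) →
      length T + suc (length T * 2) < length Y → ∀ hs → Unique hs → (∀ {h} → h ∈ hs → h ∈ T) → length hs ≤ length T →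
      ∃[ p ] (vertex {Adj = Adj} {ℓ = length hs * 2} p zero ∈ Y × (∀ i → vertex p i ∈ hs ⊎ vertex p i ∉ T))
    alternating-path {T} {Y} uY complete big [] _ _ _
      with y , y∈Y , y∉T ← pick-fresh uY T (≤-<-trans (m≤m+n _ _) big) =
      path-single y , y∈Y , λ _ → inj₂ y∉T
    alternating-path {T} {Y} uY complete big (h ∷ hs) (h∉hs ∷ u) hs⊆T 1+hs≤T
      with p , head∈Y , place ← alternating-path uY complete big hs u (hs⊆T ∘ there) (<⇒≤ 1+hs≤T) =
      path-cons y p₁ (complete y∈Y (hs⊆T (here refl)))
        (λ i eq → y∉ (∈-++⁺ʳ T (subst (_∈ List.tabulate (vertex p₁)) (sym eq) (∈-tabulate⁺ {f = vertex p₁} i)))) ,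
      y∈Y ,
      λ { zero          → inj₂ (y∉ ∘ ∈-++⁺ˡ)
        ; (suc zero)    → inj₁ (here refl)
        ; (suc (suc i)) → [ inj₁ ∘ there , inj₂ ]′ (place i) }
      where
      p₁ : Path Adj (suc (length hs * 2))
      p₁ = path-cons h p (adj-sym (complete head∈Y (hs⊆T (here refl)))) λ i eq →
        [ (λ pi∈ → All.lookup h∉hs pi∈ eq) , (λ pi∉ → pi∉ (subst (_∈ T) eq (hs⊆T (here refl)))) ]′ (place i)
      used : List (Fin n)
      used = T ++ List.tabulate (vertex p₁)
      used-small : length used < length Y
      used-small = ≤-<-trans (begin
        length used                                         ≡⟨ Listₚ.length-++ T ⟩
        length T + length (List.tabulate (vertex p₁))       ≡⟨ cong (length T +_) (Listₚ.length-tabulate (vertex p₁)) ⟩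
        length T + (suc (length hs) * 2)                    ≤⟨ +-monoʳ-≤ (length T) (*-monoˡ-≤ 2 1+hs≤T) ⟩
        length T + length T * 2                             ≤⟨ +-monoʳ-≤ (length T) (n≤1+n _) ⟩
        length T + suc (length T * 2)                       ∎) big
        where open ≤-Reasoning
      fresh = pick-fresh uY used used-small
      y = proj₁ fresh
      y∈Y = proj₁ (proj₂ fresh)
      y∉ = proj₂ (proj₂ fresh)

    module _ {t} (noPath : ¬ Path Adj (suc t * 2)) where

      common-neighbours≤ : ∀ T → length T ≡ suc t → Unique T → AtMost (hubFactor t) (λ y → All (Adj y) T)
      common-neighbours≤ T T≡ uT Y uY all with hubFactor t <? length Y
      ... | no ≯    = ≮⇒≥ ≯
      ... | yes big = ⊥-elim (noPath (subst (λ a → Path Adj (a * 2)) T≡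
        (proj₁ (alternating-path {T} {Y} uY (λ y∈ h∈ → All.lookup (All.lookup all y∈) h∈)
          (subst (λ a → a + suc (a * 2) < length Y) (sym T≡) big) T uT id ≤-refl))))

      -- `T` collects neighbours already fixed, and `r` more are wanted from `xs`. Branching on
      -- whether `y` is joined to the next `x` gives at most `2 ^ length xs` cases, each ending in
      -- `suc t` fixed neighbours, where `common-neighbours≤` applies, or running out of `xs`.
      many-hubs≤ : ∀ xs T r → length T + r ≡ suc t → Unique T → Unique xs → (∀ {x} → x ∈ xs → x ∉ T) →
        AtMost (2 ^ length xs * hubFactor t) (λ y → All (Adj y) T × r ≤ length (filter (Adj? y) xs))
      many-hubs≤ xs T zero T+r uT _ _ =
        atMost-mono proj₁ (m≤n*m (hubFactor t) (2 ^ length xs) {{m^n≢0 2 (length xs)}})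
          (common-neighbours≤ T (trans (sym (+-identityʳ _)) T+r) uT)
      many-hubs≤ []       T (suc r) T+r uT _ _ = atMost-mono id z≤n (atMost-0 λ ())
      many-hubs≤ (x ∷ xs) T (suc r) T+r uT (x∉xs ∷ u) apart =
        atMost-mono id (≤-reflexive (rearrange (2 ^ length xs) (hubFactor t)))
          (atMost-⊎ (λ y → All.all? (Adj? y) (x ∷ T) ×-dec (r ≤? length (filter (Adj? y) xs))) split
            (many-hubs≤ xs (x ∷ T) r (trans (sym (+-suc _ _)) T+r)
              (All.tabulate (λ {z} z∈T x≡z → apart (here refl) (subst (_∈ T) (sym x≡z) z∈T)) ∷ uT) u
              (λ { z∈xs (here refl) → All.lookup x∉xs z∈xs refl ; z∈xs (there z∈T) → apart (there z∈xs) z∈T }))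
            (many-hubs≤ xs T (suc r) T+r uT u (apart ∘ there)))
        where
        split : ∀ {y} → All (Adj y) T × suc r ≤ length (filter (Adj? y) (x ∷ xs)) →
                (All (Adj y) (x ∷ T) × r ≤ length (filter (Adj? y) xs)) ⊎
                (All (Adj y) T × suc r ≤ length (filter (Adj? y) xs))
        split {y} (all , r<) with Adj? y x
        ... | yes adj = inj₁ (adj ∷ all , ≤-pred r<)
        ... | no _    = inj₂ (all , r<)
        rearrange : ∀ a b → a * b + a * b ≡ 2 * a * b
        rearrange = solve-∀

      -- Double counting: a vertex contributes at most `t`, apart from the boundedly many with more
      -- than `t` neighbours in `H`, which contribute at most `length H` each.
      hub-degree-sum≤ : ∀ H → Unique H → ∑ H degree ≤ n * t + 2 ^ length H * hubFactor t * length H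
      hub-degree-sum≤ H uH = begin
        ∑ H degree                                                   ≡⟨ ∑-swap H (allFin n) ⟦Adj⟧ ⟩
        ∑ (allFin n) (λ y → ∑ H (λ x → ⟦Adj⟧ x y))                   ≤⟨ ∑-mono (allFin n) (λ {y} _ → pointwise y) ⟩
        ∑ (allFin n) (λ y → t + length H * ⟦ many? y ⟧)              ≡⟨ ∑-+ (allFin n) (λ _ → t) (λ y → length H * ⟦ many? y ⟧) ⟩
        ∑ (allFin n) (λ _ → t) + ∑ (allFin n) (λ y → length H * ⟦ many? y ⟧)
          ≡⟨ cong₂ _+_ (trans (∑-const (allFin n) t) (cong (_* t) (length-allFin n))) (∑-*ˡ (allFin n) (length H) (λ y → ⟦ many? y ⟧)) ⟩
        n * t + length H * ∑ (allFin n) (λ y → ⟦ many? y ⟧)          ≡⟨ cong (λ a → n * t + length H * a) (∑-⟦⟧ many? (allFin n)) ⟩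
        n * t + length H * length (filter many? (allFin n))          ≤⟨ +-monoʳ-≤ (n * t) (*-monoʳ-≤ (length H) few) ⟩
        n * t + length H * (2 ^ length H * hubFactor t)                ≡⟨ cong (n * t +_) (*-comm (length H) _) ⟩
        n * t + 2 ^ length H * hubFactor t * length H                  ∎
        where
        open ≤-Reasoning
        many? : ∀ y → Dec (suc t ≤ length (filter (Adj? y) H))
        many? y = suc t ≤? length (filter (Adj? y) H)
        few : length (filter many? (allFin n)) ≤ 2 ^ length H * hubFactor t
        few = many-hubs≤ H [] (suc t) refl [] uH (λ _ ()) (filter many? (allFin n))
          (Uniqueₚ.filter⁺ many? (Uniqueₚ.allFin⁺ n)) (All.tabulate λ y∈ → [] , proj₂ (∈-filter⁻ many? {xs = allFin n} y∈))
        pointwise : ∀ y → ∑ H (λ x → ⟦Adj⟧ x y) ≤ t + length H * ⟦ many? y ⟧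
        pointwise y = ≤-trans (∑-mono H (λ {x} _ → ≤-reflexive (⟦Adj⟧-sym x y)))
          (≤-trans (≤-reflexive (∑-⟦⟧ (Adj? y) H)) bound)
          where
          bound : length (filter (Adj? y) H) ≤ t + length H * ⟦ many? y ⟧
          bound with many? y
          ... | no ¬many = ≤-trans (≤-pred (≰⇒> ¬many)) (m≤m+n t _)
          ... | yes _    = ≤-trans (Listₚ.length-filter (Adj? y) H)
            (≤-trans (≤-reflexive (sym (*-identityʳ (length H)))) (m≤n+m _ t))

  -- Binomial coefficients

  -- The absorption identity, by induction with Pascal's rule; it drives the comparisons of binomial
  -- coefficients below.
  C-absorb : ∀ n j → suc j * (suc n C suc j) ≡ suc n * (n C j)
  C-absorb zero    zero    = refl
  C-absorb zero    (suc j) = *-zeroʳ (suc (suc j))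
  C-absorb (suc n) zero    = trans (*-identityˡ _) (trans (nC1≡n (suc (suc n))) (sym (*-identityʳ _)))
  C-absorb (suc n) (suc j) = begin
    suc (suc j) * (suc (suc n) C suc (suc j))                     ≡⟨ cong (suc (suc j) *_) (nCk+nC[k+1]≡[n+1]C[k+1] (suc n) (suc j)) ⟨
    suc (suc j) * (x + y)                                         ≡⟨ expand j x y ⟩
    x + (suc j * x + suc (suc j) * y)                             ≡⟨ cong (x +_) (cong₂ _+_ (C-absorb n j) (C-absorb n (suc j))) ⟩
    x + (suc n * (n C j) + suc n * (n C suc j))                   ≡⟨ cong (x +_) (*-distribˡ-+ (suc n) (n C j) (n C suc j)) ⟨
    x + suc n * (n C j + n C suc j)                               ≡⟨ cong (λ a → x + suc n * a) (nCk+nC[k+1]≡[n+1]C[k+1] n j) ⟩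
    suc (suc n) * x                                               ∎
    where
    open ≡-Reasoning
    x = suc n C suc j
    y = suc n C suc (suc j)
    expand : ∀ j x y → suc (suc j) * (x + y) ≡ x + (suc j * x + suc (suc j) * y)
    expand = solve-∀

  C-monoˡ : ∀ {m n} j → m ≤ n → m C j ≤ n C j
  C-monoˡ zero    _         = ≤-refl
  C-monoˡ (suc j) z≤n       = z≤n
  C-monoˡ {suc m} {suc n} (suc j) (s≤s m≤n) = *-cancelˡ-≤ (suc j) (begin
    suc j * (suc m C suc j)   ≡⟨ C-absorb m j ⟩
    suc m * (m C j)           ≤⟨ *-mono-≤ (s≤s m≤n) (C-monoˡ j m≤n) ⟩
    suc n * (n C j)           ≡⟨ C-absorb n j ⟨
    suc j * (suc n C suc j)   ∎)
    where open ≤-Reasoning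

  C-ratio : ∀ {m n} j → m ≤ n → n * (m C suc j) ≤ m * (n C suc j)
  C-ratio {n = n} j z≤n = ≤-reflexive (*-zeroʳ n)
  C-ratio {suc m} {suc n} j (s≤s m≤n) = *-cancelˡ-≤ (suc j) (begin
    suc j * (suc n * (suc m C suc j))   ≡⟨ swap (suc j) (suc n) (suc m C suc j) ⟩
    suc n * (suc j * (suc m C suc j))   ≡⟨ cong (suc n *_) (C-absorb m j) ⟩
    suc n * (suc m * (m C j))           ≤⟨ *-monoʳ-≤ (suc n) (*-monoʳ-≤ (suc m) (C-monoˡ j m≤n)) ⟩
    suc n * (suc m * (n C j))           ≡⟨ swap (suc n) (suc m) (n C j) ⟩
    suc m * (suc n * (n C j))           ≡⟨ cong (suc m *_) (C-absorb n j) ⟨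
    suc m * (suc j * (suc n C suc j))   ≡⟨ swap (suc m) (suc j) (suc n C suc j) ⟩
    suc j * (suc m * (suc n C suc j))   ∎)
    where
    open ≤-Reasoning
    swap : ∀ a b c → a * (b * c) ≡ b * (a * c)
    swap = solve-∀

  -- One factor m/n comes from absorption, the other from `C-ratio` applied to the predecessors of
  -- `m` and `n`.
  C-ratio² : ∀ {m n j} → 2 ≤ j → m ≤ n → n * n * (m C j) ≤ m * m * (n C j)
  C-ratio² {n = n} (s≤s (s≤s _)) z≤n = ≤-reflexive (*-zeroʳ (n * n))
  C-ratio² {suc m} {suc n} {suc (suc j)} (s≤s (s≤s z≤n)) (s≤s m≤n) = *-cancelˡ-≤ (suc (suc j)) (begin
    suc (suc j) * (suc n * suc n * (suc m C suc (suc j)))   ≡⟨ swap (suc (suc j)) (suc n * suc n) (suc m C suc (suc j)) ⟩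
    suc n * suc n * (suc (suc j) * (suc m C suc (suc j)))   ≡⟨ cong (suc n * suc n *_) (C-absorb m (suc j)) ⟩
    suc n * suc n * (suc m * x)                             ≡⟨ regroup (suc n) (suc m) x ⟩
    suc n * suc m * (x + n * x)                             ≤⟨ *-monoʳ-≤ (suc n * suc m) (+-mono-≤ (C-monoˡ (suc j) m≤n) (C-ratio j m≤n)) ⟩
    suc n * suc m * (y + m * y)                             ≡⟨ regroup′ (suc n) (suc m) y ⟩
    suc m * suc m * (suc n * y)                             ≡⟨ cong (suc m * suc m *_) (C-absorb n (suc j)) ⟨
    suc m * suc m * (suc (suc j) * (suc n C suc (suc j)))   ≡⟨ swap (suc m * suc m) (suc (suc j)) (suc n C suc (suc j)) ⟩
    suc (suc j) * (suc m * suc m * (suc n C suc (suc j)))   ∎)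
    where
    open ≤-Reasoning
    x = m C suc j
    y = n C suc j
    swap : ∀ a b c → a * (b * c) ≡ b * (a * c)
    swap = solve-∀
    regroup : ∀ a b c → a * a * (b * c) ≡ a * b * (a * c)
    regroup = solve-∀
    regroup′ : ∀ a b c → a * b * (b * c) ≡ b * b * (a * c)
    regroup′ = solve-∀

  -- This is 2^j · j!.
  powerFactor : ℕ → ℕ
  powerFactor zero    = 1
  powerFactor (suc j) = powerFactor j * (2 * suc j)

  -- The ratio of C(n, j+1) to C(n, j) is (n - j)/(j + 1), which is at least n/(2(j + 1)) once n ≥
  -- 2j. Hence terms of order n^(k-2) are negligible against C(n, k-1).
  ^≤powerFactor*C : ∀ {n} j → 2 * j ≤ n → n ^ j ≤ powerFactor j * (n C j)
  ^≤powerFactor*C zero _ = ≤-refl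
  ^≤powerFactor*C {suc n} (suc j) 2j≤n = begin
    suc n * suc n ^ j                               ≤⟨ *-monoʳ-≤ (suc n) (^≤powerFactor*C j (≤-trans (*-monoʳ-≤ 2 (n≤1+n j)) 2j≤n)) ⟩
    suc n * (powerFactor j * x)                     ≡⟨ swap (suc n) (powerFactor j) x ⟩
    powerFactor j * (suc n * x)                     ≤⟨ *-monoʳ-≤ (powerFactor j) step ⟩
    powerFactor j * (2 * suc j * y)                 ≡⟨ *-assoc (powerFactor j) (2 * suc j) y ⟨
    powerFactor j * (2 * suc j) * y                 ∎
    where
    open ≤-Reasoning
    x = suc n C j
    y = suc n C suc j
    swap : ∀ a b c → a * (b * c) ≡ b * (a * c)
    swap = solve-∀
    recurrence : suc j * x + suc j * y ≡ x + suc n * x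
    recurrence = trans (sym (*-distribˡ-+ (suc j) x y)) (trans (cong (suc j *_) (nCk+nC[k+1]≡[n+1]C[k+1] (suc n) j)) (C-absorb (suc n) j))
    double : ∀ j x y → (2 * suc j) * x + 2 * suc j * y ≡ 2 * (suc j * x + suc j * y)
    double = solve-∀
    step : suc n * x ≤ 2 * suc j * y
    step = +-cancelˡ-≤ (suc n * x) _ _ (begin
      suc n * x + suc n * x                   ≤⟨ m≤n+m _ (2 * x) ⟩
      2 * x + (suc n * x + suc n * x)         ≡⟨ two x (suc n * x) ⟩
      2 * (x + suc n * x)                     ≡⟨ cong (2 *_) recurrence ⟨
      2 * (suc j * x + suc j * y)             ≡⟨ double j x y ⟨
      2 * suc j * x + 2 * suc j * y           ≤⟨ +-monoˡ-≤ (2 * suc j * y) (*-monoˡ-≤ x 2j≤n) ⟩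
      suc n * x + 2 * suc j * y               ∎)
      where
      two : ∀ a b → 2 * a + (b + b) ≡ 2 * (a + b)
      two = solve-∀

  -- Degrees concentrate on at most t vertices

  -- Inequalities at one vertex of degree `d`, to be summed over all vertices. A vertex is high when
  -- d ≥ n/Q; a low one has Q·d² ≤ n·d, which is the error term in each sum.
  module Pointwise {n d Q : ℕ} (d≤n : d ≤ n) (2≤Q : 2 ≤ Q) where

    open ≤-Reasoning

    low-square : ¬ n ≤ Q * d → Q * (d * d) ≤ n * d
    low-square low = ≤-trans (≤-reflexive (sym (*-assoc Q d d))) (*-monoˡ-≤ d (<⇒≤ (≰⇒> low)))

    square : (high? : Dec (n ≤ Q * d)) → Q * (d * d) ≤ Q * (d * (⟦ high? ⟧ * d)) + n * d
    square (yes _)  = ≤-trans (≤-reflexive (cong (λ a → Q * (d * a)) (sym (*-identityˡ d)))) (m≤m+n _ (n * d))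
    square (no low) = ≤-trans (low-square low) (m≤n+m (n * d) _)

    -- At a high vertex with 2d < n the gap n·d - d² is at least d². At every other high vertex the
    -- gap is nonnegative.
    small-square : (high? : Dec (n ≤ Q * d)) (small? : Dec (2 * d < n)) →
      Q * (⟦ small? ⟧ * (d * d)) + Q * (d * (⟦ high? ⟧ * d)) ≤ Q * (n * (⟦ high? ⟧ * d)) + n * d
    small-square (yes _) (yes 2d<n) = begin
      Q * (1 * (d * d)) + Q * (d * (1 * d))     ≡⟨ lemma Q d ⟩
      Q * (2 * d * (1 * d))                     ≤⟨ *-monoʳ-≤ Q (*-monoˡ-≤ (1 * d) (<⇒≤ 2d<n)) ⟩
      Q * (n * (1 * d))                         ≤⟨ m≤m+n _ (n * d) ⟩
      Q * (n * (1 * d)) + n * d                 ∎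
      where
      lemma : ∀ Q d → Q * (1 * (d * d)) + Q * (d * (1 * d)) ≡ Q * (2 * d * (1 * d))
      lemma = solve-∀
    small-square (yes _) (no _) = begin
      Q * 0 + Q * (d * (1 * d))                 ≡⟨ cong (_+ Q * (d * (1 * d))) (*-zeroʳ Q) ⟩
      Q * (d * (1 * d))                         ≤⟨ *-monoʳ-≤ Q (*-monoˡ-≤ (1 * d) d≤n) ⟩
      Q * (n * (1 * d))                         ≤⟨ m≤m+n _ (n * d) ⟩
      Q * (n * (1 * d)) + n * d                 ∎
    small-square (no low) (yes _) = begin
      Q * (1 * (d * d)) + Q * (d * 0)           ≡⟨ lemma Q d ⟩
      Q * (d * d)                               ≤⟨ low-square low ⟩
      n * d                                     ≤⟨ m≤n+m (n * d) (Q * (n * 0)) ⟩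
      Q * (n * 0) + n * d                       ∎
      where
      lemma : ∀ Q d → Q * (1 * (d * d)) + Q * (d * 0) ≡ Q * (d * d)
      lemma = solve-∀
    small-square (no _) (no _) = ≤-trans (≤-reflexive (lemma Q d)) z≤n
      where
      lemma : ∀ Q d → Q * 0 + Q * (d * 0) ≡ 0
      lemma = solve-∀

    -- For n ≤ 2d this is (n − d)(2d − n) ≥ 0.
    large-square : (high? : Dec (n ≤ Q * d)) (large? : Dec (n ≤ 2 * d)) →
      n * n * ⟦ large? ⟧ + 2 * (d * (⟦ high? ⟧ * d)) ≤ 3 * (n * (⟦ high? ⟧ * d))
    large-square (yes _) (yes n≤2d)
      with u , refl ← m≤n⇒∃[o]m+o≡n d≤n
      with w , 2d≡ ← m≤n⇒∃[o]m+o≡n n≤2d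
      with refl ← +-cancelˡ-≡ d d (u + w) (trans (cong (d +_) (sym (+-identityʳ d))) (trans (sym 2d≡) (+-assoc d u w))) =
      ≤-trans (m≤m+n _ (u * w)) (≤-reflexive (lemma u w))
      where
      lemma : ∀ u w → (u + w + u) * (u + w + u) * 1 + 2 * ((u + w) * (1 * (u + w))) + u * w
                      ≡ 3 * ((u + w + u) * (1 * (u + w)))
      lemma = solve-∀
    large-square (yes _) (no _) = begin
      n * n * 0 + 2 * (d * (1 * d))             ≡⟨ cong (_+ 2 * (d * (1 * d))) (*-zeroʳ (n * n)) ⟩
      2 * (d * (1 * d))                         ≤⟨ *-mono-≤ (n≤1+n 2) (*-monoˡ-≤ (1 * d) d≤n) ⟩
      3 * (n * (1 * d))                         ∎
    large-square (no low) (yes n≤2d) = ⊥-elim (low (≤-trans n≤2d (*-monoˡ-≤ d 2≤Q)))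
    large-square (no _)   (no _)     = ≤-trans (≤-reflexive (lemma n d)) z≤n
      where
      lemma : ∀ n d → n * n * 0 + 2 * (d * 0) ≡ 0
      lemma = solve-∀

  -- `D₁` and `D₂` are the sums of d and d² over all vertices, `A` and `AD` the same sums over high
  -- vertices, `G` the sum of d² over vertices with 2d < n, and `σ` the number of the remaining
  -- vertices. The threshold for high is n/(q·c).
  module Concentrate {q t c n D₁ D₂ A AD G σ : ℕ} .{{_ : NonZero c}} .{{_ : NonZero n}}
    (degrees   : D₁ ≤ n * c)
    (squares   : q * c * D₂ ≤ q * c * AD + n * D₁)
    (smalls    : q * c * G + q * c * AD ≤ q * c * (n * A) + n * D₁)
    (larges    : n * n * σ + 2 * AD ≤ 3 * (n * A))
    (hubs      : q * A ≤ q * (n * t) + n)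
    (dense     : q * t * (n * n) ≤ 2 * (n * n) + q * D₂)
    where

    open ≤-Reasoning

    private
      nn = n * n

    n*D₁≤ : n * D₁ ≤ c * nn
    n*D₁≤ = ≤-trans (*-monoʳ-≤ n degrees) (≤-reflexive (lemma n c))
      where
      lemma : ∀ n c → n * (n * c) ≡ c * (n * n)
      lemma = solve-∀

    n*q*A≤ : n * (q * A) ≤ q * t * nn + nn
    n*q*A≤ = ≤-trans (*-monoʳ-≤ n hubs) (≤-reflexive (lemma n q t))
      where
      lemma : ∀ n q t → n * (q * (n * t) + n) ≡ q * t * (n * n) + n * n
      lemma = solve-∀

    dense′ : q * t * nn ≤ 3 * nn + q * AD
    dense′ = begin
      q * t * nn                 ≤⟨ dense ⟩
      2 * nn + q * D₂            ≤⟨ +-monoʳ-≤ (2 * nn) squares′ ⟩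
      2 * nn + (q * AD + nn)     ≡⟨ lemma nn (q * AD) ⟩
      3 * nn + q * AD            ∎
      where
      lemma : ∀ a b → 2 * a + (b + a) ≡ 3 * a + b
      lemma = solve-∀
      assoc : ∀ c q x → c * (q * x) ≡ q * c * x
      assoc = solve-∀
      squares′ : q * D₂ ≤ q * AD + nn
      squares′ = *-cancelˡ-≤ c (begin
        c * (q * D₂)             ≡⟨ assoc c q D₂ ⟩
        q * c * D₂               ≤⟨ squares ⟩
        q * c * AD + n * D₁      ≤⟨ +-mono-≤ (≤-reflexive (sym (assoc c q AD))) n*D₁≤ ⟩
        c * (q * AD) + c * nn    ≡⟨ *-distribˡ-+ c (q * AD) nn ⟨
        c * (q * AD + nn)        ∎)

    -- In units of n²: q·n·A exceeds q·t by at most 1, q·AD falls short of it by at most 3, and low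
    -- vertices add 1, which makes 5.
    smalls≤ : q * G ≤ 5 * nn
    smalls≤ = +-cancelʳ-≤ (q * AD) _ _ (begin
      q * G + q * AD               ≤⟨ smalls′ ⟩
      n * (q * A) + nn             ≤⟨ +-monoˡ-≤ nn n*q*A≤ ⟩
      q * t * nn + nn + nn         ≤⟨ +-monoˡ-≤ nn (+-monoˡ-≤ nn dense′) ⟩
      3 * nn + q * AD + nn + nn    ≡⟨ lemma nn (q * AD) ⟩
      5 * nn + q * AD              ∎)
      where
      lemma : ∀ a b → 3 * a + b + a + a ≡ 5 * a + b
      lemma = solve-∀
      left : ∀ c q x y → c * (q * x + q * y) ≡ q * c * x + q * c * y
      left = solve-∀
      right : ∀ c q n A x → q * c * (n * A) + c * x ≡ c * (n * (q * A) + x)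
      right = solve-∀
      smalls′ : q * G + q * AD ≤ n * (q * A) + nn
      smalls′ = *-cancelˡ-≤ c (begin
        c * (q * G + q * AD)             ≡⟨ left c q G AD ⟩
        q * c * G + q * c * AD           ≤⟨ smalls ⟩
        q * c * (n * A) + n * D₁         ≤⟨ +-monoʳ-≤ (q * c * (n * A)) n*D₁≤ ⟩
        q * c * (n * A) + c * nn         ≡⟨ right c q n A nn ⟩
        c * (n * (q * A) + nn)           ∎)

    -- The same estimates enter 3·n·A - 2·AD: the excess contributes 3 and the shortfall 2 · 3,
    -- hence 9.
    larges≤ : q * σ ≤ q * t + 9
    larges≤ = *-cancelʳ-≤ _ _ nn {{m*n≢0 n n}} (+-cancelʳ-≤ (2 * (q * AD)) _ _ (begin
      q * σ * nn + 2 * (q * AD)                     ≡⟨ left q σ nn AD ⟩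
      q * (nn * σ + 2 * AD)                         ≤⟨ *-monoʳ-≤ q larges ⟩
      q * (3 * (n * A))                             ≡⟨ middle q n A ⟩
      3 * (n * (q * A))                             ≤⟨ *-monoʳ-≤ 3 n*q*A≤ ⟩
      3 * (q * t * nn + nn)                         ≡⟨ split (q * t * nn) nn ⟩
      q * t * nn + 3 * nn + 2 * (q * t * nn)        ≤⟨ +-monoʳ-≤ (q * t * nn + 3 * nn) (*-monoʳ-≤ 2 dense′) ⟩
      q * t * nn + 3 * nn + 2 * (3 * nn + q * AD)   ≡⟨ right (q * t) nn (q * AD) ⟩
      (q * t + 9) * nn + 2 * (q * AD)               ∎))
      where
      left : ∀ q s x y → q * s * x + 2 * (q * y) ≡ q * (x * s + 2 * y)
      left = solve-∀
      middle : ∀ q n A → q * (3 * (n * A)) ≡ 3 * (n * (q * A))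
      middle = solve-∀
      split : ∀ x y → 3 * (x + y) ≡ x + 3 * y + 2 * x
      split = solve-∀
      right : ∀ x y z → x * y + 3 * y + 2 * (3 * y + z) ≡ (x + 9) * y + 2 * z
      right = solve-∀

  superset-of-size : ∀ {n} (A : Subset n) {t} → ∣ A ∣ ≤ t → t ≤ n → ∃[ S ] (A ⊆ˢ S × ∣ S ∣ ≡ t)
  superset-of-size []            z≤n z≤n = [] , id , refl
  superset-of-size (inside  ∷ A) {suc t} (s≤s A≤t) (s≤s t≤n) =
    let S , A⊆S , S≡t = superset-of-size A A≤t t≤n in inside ∷ S , Subₚ.s⊆s A⊆S , cong suc S≡t
  superset-of-size {suc n} (outside ∷ A) {t} A≤t t≤1+n with t ≤? n
  ... | yes t≤n = let S , A⊆S , S≡t = superset-of-size A A≤t t≤n in outside ∷ S , Subₚ.s⊆s A⊆S , S≡t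
  ... | no  t≰n = Sub.⊤ , (λ _ → Subₚ.∈⊤) , trans (Subₚ.∣⊤∣≡n (suc n)) (≤-antisym (≰⇒> t≰n) t≤1+n)

  -- The bound on the average degree given by `degree-sum≤` for paths with `suc t * 2` edges.
  edgeFactor : ℕ → ℕ
  edgeFactor t = 2 * suc (suc t * 2)

  -- The additive error of `hub-degree-sum≤` with the number of hubs replaced by its bound from
  -- `hubs≤`.
  hubConstant : ℕ → ℕ → ℕ
  hubConstant q t = 2 ^ (q * edgeFactor t * edgeFactor t) * hubFactor t * (q * edgeFactor t * edgeFactor t)

  module DegreeConcentration {n : ℕ} {Adj : Fin n → Fin n → Set} (Adj? : ∀ x y → Dec (Adj x y))
    (adj-sym : ∀ {x y} → Adj x y → Adj y x) {t q : ℕ} .{{_ : NonZero n}} (2≤q : 2 ≤ q)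
    (noPath : ¬ Path Adj (suc t * 2)) where

    open PathFree Adj? adj-sym

    private
      D = edgeFactor t
      Θ = q * edgeFactor t

    -- The threshold n/Θ is chosen so that the low vertices contribute at most (n/Θ) · n · D = n²/q
    -- to the sum of squared degrees.
    high? : ∀ x → Dec (n ≤ Θ * degree x)
    high? x = n ≤? Θ * degree x

    large? : ∀ x → Dec (n ≤ 2 * degree x)
    large? x = n ≤? 2 * degree x

    small? : ∀ x → Dec (2 * degree x < n)
    small? x = 2 * degree x <? n

    module _ (qK≤n : q * hubConstant q t ≤ n)
             (dense : q * t * (n * n) ≤ 2 * (n * n) + q * ∑ (allFin n) (λ x → degree x * degree x)) where

      open ≤-Reasoning

      private
        V = allFin n

      2≤Θ : 2 ≤ Θ
      2≤Θ = ≤-trans 2≤q (m≤m*n q D)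

      hub g : Fin n → ℕ
      hub x = ⟦ high? x ⟧ * degree x
      g x   = ⟦ small? x ⟧ * (degree x * degree x)

      -- Markov's inequality: each high vertex takes n/Θ out of a degree sum of at most n · D.
      hubs≤ : length (filter high? V) ≤ Θ * D
      hubs≤ = *-cancelʳ-≤ _ _ n (begin
        length (filter high? V) * n                          ≡⟨ ∑-const (filter high? V) n ⟨
        ∑ (filter high? V) (λ _ → n)                         ≤⟨ ∑-mono (filter high? V) (λ x∈ → proj₂ (∈-filter⁻ high? {xs = V} x∈)) ⟩
        ∑ (filter high? V) (λ x → Θ * degree x)              ≤⟨ ∑-filter-≤ high? V (λ x → Θ * degree x) ⟩
        ∑ V (λ x → Θ * degree x)                             ≡⟨ ∑-*ˡ V Θ degree ⟩
        Θ * ∑ V degree                                       ≤⟨ *-monoʳ-≤ Θ (degree-sum≤ noPath) ⟩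
        Θ * (n * D)                                          ≡⟨ lemma Θ n D ⟩
        Θ * D * n                                            ∎)
        where
        lemma : ∀ a b c → a * (b * c) ≡ a * c * b
        lemma = solve-∀

      q*∑hub≤ : q * ∑ V hub ≤ q * (n * t) + n
      q*∑hub≤ = begin
        q * ∑ V hub                                          ≡⟨ cong (q *_) (∑-⟦⟧-* high? degree V) ⟩
        q * ∑ H degree                                       ≤⟨ *-monoʳ-≤ q (hub-degree-sum≤ noPath H (Uniqueₚ.filter⁺ high? (Uniqueₚ.allFin⁺ n))) ⟩
        q * (n * t + 2 ^ length H * hubFactor t * length H)  ≤⟨ *-monoʳ-≤ q (+-monoʳ-≤ (n * t)
                                                                 (*-mono-≤ (*-monoˡ-≤ (hubFactor t) (^-monoʳ-≤ 2 hubs≤)) hubs≤)) ⟩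
        q * (n * t + hubConstant q t)                                      ≡⟨ *-distribˡ-+ q (n * t) (hubConstant q t) ⟩
        q * (n * t) + q * hubConstant q t                                  ≤⟨ +-monoʳ-≤ (q * (n * t)) qK≤n ⟩
        q * (n * t) + n                                      ∎
        where
        H = filter high? V

      private
        module P x = Pointwise {n} {degree x} {Θ} (degree≤n x) 2≤Θ

      D₁ D₂ hubs hub·d G σ : ℕ
      D₁ = ∑ V degree
      D₂ = ∑ V (λ x → degree x * degree x)
      hubs  = ∑ V hub
      hub·d = ∑ V (λ x → degree x * hub x)
      G  = ∑ V g
      σ  = ∑ V (λ x → ⟦ large? x ⟧)

      squares≤ : Θ * D₂ ≤ Θ * hub·d + n * D₁
      squares≤ = begin
        Θ * D₂                                                           ≡⟨ ∑-*ˡ V Θ _ ⟨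
        ∑ V (λ x → Θ * (degree x * degree x))                            ≤⟨ ∑-mono V (λ {x} _ → P.square x (high? x)) ⟩
        ∑ V (λ x → Θ * (degree x * hub x) + n * degree x)                ≡⟨ ∑-+ V _ _ ⟩
        ∑ V (λ x → Θ * (degree x * hub x)) + ∑ V (λ x → n * degree x)    ≡⟨ cong₂ _+_ (∑-*ˡ V Θ _) (∑-*ˡ V n degree) ⟩
        Θ * hub·d + n * D₁                                                  ∎

      small-squares≤ : Θ * G + Θ * hub·d ≤ Θ * (n * hubs) + n * D₁
      small-squares≤ = begin
        Θ * G + Θ * hub·d                                               ≡⟨ cong₂ _+_ (∑-*ˡ V Θ g) (∑-*ˡ V Θ _) ⟨
        ∑ V (λ x → Θ * g x) + ∑ V (λ x → Θ * (degree x * hub x))     ≡⟨ ∑-+ V _ _ ⟨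
        ∑ V (λ x → Θ * g x + Θ * (degree x * hub x))                 ≤⟨ ∑-mono V (λ {x} _ → P.small-square x (high? x) (small? x)) ⟩
        ∑ V (λ x → Θ * (n * hub x) + n * degree x)                   ≡⟨ ∑-+ V _ _ ⟩
        ∑ V (λ x → Θ * (n * hub x)) + ∑ V (λ x → n * degree x)       ≡⟨ cong₂ _+_ (trans (∑-*ˡ V Θ _) (cong (Θ *_) (∑-*ˡ V n hub))) (∑-*ˡ V n degree) ⟩
        Θ * (n * hubs) + n * D₁                                         ∎

      large-squares≤ : n * n * σ + 2 * hub·d ≤ 3 * (n * hubs)
      large-squares≤ = begin
        n * n * σ + 2 * hub·d                                                       ≡⟨ cong₂ _+_ (∑-*ˡ V (n * n) _) (∑-*ˡ V 2 _) ⟨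
        ∑ V (λ x → n * n * ⟦ large? x ⟧) + ∑ V (λ x → 2 * (degree x * hub x))    ≡⟨ ∑-+ V _ _ ⟨
        ∑ V (λ x → n * n * ⟦ large? x ⟧ + 2 * (degree x * hub x))                ≤⟨ ∑-mono V (λ {x} _ → P.large-square x (high? x) (large? x)) ⟩
        ∑ V (λ x → 3 * (n * hub x))                                              ≡⟨ trans (∑-*ˡ V 3 _) (cong (3 *_) (∑-*ˡ V n hub)) ⟩
        3 * (n * hubs)                                                              ∎

      private
        module Conclusion = Concentrate {q} {t} {D} {n} {D₁} {D₂} {hubs} {hub·d} {G} {σ}
          (degree-sum≤ noPath) squares≤ small-squares≤ large-squares≤ q*∑hub≤ dense

      small-degrees≤ : q * ∑ V g ≤ 5 * (n * n)
      small-degrees≤ = Conclusion.smalls≤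

      large-degrees≤ : 10 ≤ q → length (filter large? V) ≤ t
      large-degrees≤ 10≤q = ≤-pred (*-cancelˡ-< q _ _ (begin-strict
        q * length (filter large? V)        ≡⟨ cong (q *_) (∑-⟦⟧ large? V) ⟨
        q * ∑ V (λ x → ⟦ large? x ⟧)        ≤⟨ Conclusion.larges≤ ⟩
        -- Here `q` exceeds 9, so an integer count below `t + 1` results.
        q * t + 9                           <⟨ +-monoʳ-< (q * t) 10≤q ⟩
        q * t + q                           ≡⟨ +-comm (q * t) q ⟩
        q + q * t                           ≡⟨ *-suc q t ⟨
        q * suc t                           ∎))

  -- With q = 6r + 10 and x = n², the two error terms N and 5N give q·a ≤ 6N, and 6r ≤ q leaves r·a
  -- ≤ N. The summand 10 serves the count of large degrees.
  rescale : ∀ r x N a b .{{_ : NonZero x}} → (6 * r + 10) * (x * a) ≤ N * x + N * ((6 * r + 10) * b) →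
            (6 * r + 10) * b ≤ 5 * x → r * a ≤ N
  rescale r x N a b p p′ = *-cancelˡ-≤ 6 (begin
    6 * (r * a)                             ≡⟨ *-assoc 6 r a ⟨
    6 * r * a                               ≤⟨ *-monoˡ-≤ a (m≤m+n (6 * r) 10) ⟩
    (6 * r + 10) * a                        ≤⟨ *-cancelˡ-≤ x (begin
      x * ((6 * r + 10) * a)                  ≡⟨ swap x (6 * r + 10) a ⟩
      (6 * r + 10) * (x * a)                  ≤⟨ p ⟩
      N * x + N * ((6 * r + 10) * b)          ≤⟨ +-monoʳ-≤ (N * x) (*-monoʳ-≤ N p′) ⟩
      N * x + N * (5 * x)                     ≡⟨ collect N x ⟩
      x * (6 * N)                             ∎) ⟩
    6 * N                                   ∎)
    where
    open ≤-Reasoning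
    swap : ∀ a b c → a * (b * c) ≡ b * (a * c)
    swap = solve-∀
    collect : ∀ N x → N * x + N * (5 * x) ≡ x * (6 * N)
    collect = solve-∀

  -- The stability statement over the natural numbers

  module Stability (k′ t r : ℕ) (3<k : 3 < 2 + k′) where

    -- `r` stands for 1/ε, and 1/q is the admissible loss in density. `s` is the room required by
    -- `path-expansion`. `n₀` adds up the separate lower bounds on `n` extracted below.
    k ℓ s q M j κ n₀ : ℕ
    k  = 2 + k′
    ℓ  = suc t * 2
    s  = suc ℓ + ℓ * k
    q  = 6 * r + 10
    M  = boundFactor (length (positionPairs k))
    j  = suc k′
    κ  = powerFactor j
    n₀ = suc (q * hubConstant q t + (q * (M * (s * s + s * s)) * κ + (2 * j + (t + k))))

    module _ {n : ℕ} (n₀≤n : n₀ ≤ n) (F : KFamily n k) (noPath : ¬ ContainsPath ℓ F) where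

      N bad : ℕ
      N   = n C j
      bad = M * (n ^ k′ * (s * s + s * s))

      n≢0 : NonZero n
      n≢0 = >-nonZero (≤-trans (s≤s z≤n) n₀≤n)

      E : List (Subset n)
      E = members F

      E-uniform : ∀ {A} → A ∈ E → ∣ A ∣ ≡ k
      E-uniform = All.lookup (uniform F)

      open KernelGraph E s

      noPathAdj : ¬ Path Adj ℓ
      noPathAdj p = noPath (path-expansion (s≤s (s≤s z≤n)) E-uniform ≤-refl p)

      open PathFree Adj? adj-sym

      large-n : q * hubConstant q t + (q * (M * (s * s + s * s)) * κ + (2 * j + (t + k))) ≤ n
      large-n = <⇒≤ n₀≤n

      qK≤n : q * hubConstant q t ≤ n
      qK≤n = m+n≤o⇒m≤o _ large-n

      qMc≤n : q * (M * (s * s + s * s)) * κ ≤ n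
      qMc≤n = m+n≤o⇒m≤o _ (m+n≤o⇒n≤o (q * hubConstant q t) large-n)

      2j+t+k≤n : 2 * j + (t + k) ≤ n
      2j+t+k≤n = m+n≤o⇒n≤o (q * (M * (s * s + s * s)) * κ) (m+n≤o⇒n≤o (q * hubConstant q t) large-n)

      2j≤n : 2 * j ≤ n
      2j≤n = m+n≤o⇒m≤o _ 2j+t+k≤n

      t≤n : t ≤ n
      t≤n = m+n≤o⇒m≤o _ (m+n≤o⇒n≤o (2 * j) 2j+t+k≤n)

      N≢0 : NonZero N
      N≢0 = m*n≢0⇒n≢0 κ {{>-nonZero (≤-trans (m^n>0 n {{n≢0}} j) (^≤powerFactor*C j 2j≤n))}}

      -- Multiplied by `n`, the power n^k′ becomes n^j, which is at most `κ * N`; the remaining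
      -- constant is at most `n`.
      q*bad≤N : q * bad ≤ N
      q*bad≤N = *-cancelˡ-≤ n {{n≢0}} (begin
        n * (q * bad)                                 ≡⟨ lemma n q M (n ^ k′) (s * s + s * s) ⟩
        q * (M * (s * s + s * s)) * n ^ j             ≤⟨ *-monoʳ-≤ (q * (M * (s * s + s * s))) (^≤powerFactor*C j 2j≤n) ⟩
        q * (M * (s * s + s * s)) * (κ * N)           ≡⟨ *-assoc (q * (M * (s * s + s * s))) κ N ⟨
        q * (M * (s * s + s * s)) * κ * N             ≤⟨ *-monoˡ-≤ N qMc≤n ⟩
        n * N                                         ∎)
        where
        open ≤-Reasoning
        lemma : ∀ n q M x y → n * (q * (M * (x * y))) ≡ q * (M * y) * (n * x)
        lemma = solve-∀

      binomials≤ : {P : Fin n → Set} (P? : Decidable P) →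
        n * n * ∑ (allFin n) (λ x → ⟦ P? x ⟧ * (∣ fromDec (Adj? x) ∣ C j))
          ≤ N * ∑ (allFin n) (λ x → ⟦ P? x ⟧ * (degree x * degree x))
      binomials≤ P? = begin
        n * n * ∑ V (λ x → ⟦ P? x ⟧ * (∣ fromDec (Adj? x) ∣ C j))      ≡⟨ ∑-*ˡ V (n * n) _ ⟨
        ∑ V (λ x → n * n * (⟦ P? x ⟧ * (∣ fromDec (Adj? x) ∣ C j)))    ≤⟨ ∑-mono V (λ {x} _ → pointwise x) ⟩
        ∑ V (λ x → N * (⟦ P? x ⟧ * (degree x * degree x)))             ≡⟨ ∑-*ˡ V N _ ⟩
        N * ∑ V (λ x → ⟦ P? x ⟧ * (degree x * degree x))               ∎
        where
        open ≤-Reasoning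
        V = allFin n
        swap : ∀ a b c → a * (b * c) ≡ b * (a * c)
        swap = solve-∀
        regroup : ∀ a b c → a * (b * c) ≡ c * (a * b)
        regroup = solve-∀
        neighbourhood≤ : ∀ x → ∣ fromDec (Adj? x) ∣ ≤ degree x
        neighbourhood≤ x = ≤-trans (∣fromDec∣≤ x) (≤-reflexive (sym (∑-⟦⟧ (Adj? x) V)))
        pointwise : ∀ x → n * n * (⟦ P? x ⟧ * (∣ fromDec (Adj? x) ∣ C j)) ≤ N * (⟦ P? x ⟧ * (degree x * degree x))
        pointwise x = begin
          n * n * (⟦ P? x ⟧ * (∣ fromDec (Adj? x) ∣ C j))      ≡⟨ swap (n * n) ⟦ P? x ⟧ _ ⟩
          ⟦ P? x ⟧ * (n * n * (∣ fromDec (Adj? x) ∣ C j))      ≤⟨ *-monoʳ-≤ ⟦ P? x ⟧ (*-monoʳ-≤ (n * n) (C-monoˡ j (neighbourhood≤ x))) ⟩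
          ⟦ P? x ⟧ * (n * n * (degree x C j))                  ≤⟨ *-monoʳ-≤ ⟦ P? x ⟧ (C-ratio² (<⇒≤ (≤-pred 3<k)) (degree≤n x)) ⟩
          ⟦ P? x ⟧ * (degree x * degree x * N)                 ≡⟨ regroup ⟦ P? x ⟧ (degree x * degree x) N ⟩
          N * (⟦ P? x ⟧ * (degree x * degree x))               ∎

      -- Members without a centre number at most N/q, and the others at most N/n² times the sum of
      -- d² over the vertices satisfying `P`.
      count : {P : Fin n → Set} (P? : Decidable P) → ∀ {L} → Unique L →
        All (λ A → A ∈ E × (∀ {x} → x ∈ˢ A → P x)) L →
        q * (n * n * length L) ≤ N * (n * n) + N * (q * ∑ (allFin n) (λ x → ⟦ P? x ⟧ * (degree x * degree x)))
      count P? {L} u all = begin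
        q * (n * n * length L)                    ≤⟨ *-monoʳ-≤ q (*-monoʳ-≤ (n * n)
                                                       (centred-count (Fin.fromℕ< (≤-trans (s≤s z≤n) n₀≤n)) E s E-uniform 3<k (s≤s (m≤m+n ℓ (ℓ * k))) noPathAdj P? L u all)) ⟩
        q * (n * n * (bad + Γ))                   ≡⟨ split q (n * n) bad Γ ⟩
        q * bad * (n * n) + q * (n * n * Γ)       ≤⟨ +-mono-≤ (*-monoˡ-≤ (n * n) q*bad≤N) (*-monoʳ-≤ q (binomials≤ P?)) ⟩
        N * (n * n) + q * (N * G)                 ≡⟨ cong (N * (n * n) +_) (swap q N G) ⟩
        N * (n * n) + N * (q * G)                 ∎
        where
        open ≤-Reasoning
        Γ = ∑ (allFin n) (λ x → ⟦ P? x ⟧ * (∣ fromDec (Adj? x) ∣ C j))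
        G = ∑ (allFin n) (λ x → ⟦ P? x ⟧ * (degree x * degree x))
        swap : ∀ a b c → a * (b * c) ≡ b * (a * c)
        swap = solve-∀
        split : ∀ q n a b → q * (n * (a + b)) ≡ q * a * n + q * (n * b)
        split = solve-∀

      private
        V = allFin n

      -- `count` for all of `F` turns the lower bound on the size of `F` into a lower bound on the
      -- sum of squared degrees.
      dense² : q * t * N ≤ q * size F + N → q * t * (n * n) ≤ 2 * (n * n) + q * ∑ V (λ x → degree x * degree x)
      dense² dense = *-cancelˡ-≤ N {{N≢0}} (begin
        N * (q * t * (n * n))                             ≡⟨ front N (q * t) (n * n) ⟩
        n * n * (q * t * N)                               ≤⟨ *-monoʳ-≤ (n * n) dense ⟩
        n * n * (q * size F + N)                          ≡⟨ split (n * n) q (size F) N ⟩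
        q * (n * n * size F) + N * (n * n)                ≤⟨ +-monoˡ-≤ (N * (n * n)) (count {λ _ → ⊤} (λ _ → yes tt) (distinct F)
                                                               (All.tabulate λ A∈ → A∈ , λ _ → tt)) ⟩
        N * (n * n) + N * (q * ∑ V (λ x → 1 * (degree x * degree x))) + N * (n * n)
          ≤⟨ +-monoˡ-≤ (N * (n * n)) (+-monoʳ-≤ (N * (n * n)) (*-monoʳ-≤ N (*-monoʳ-≤ q (∑-mono V λ _ → ≤-reflexive (*-identityˡ _))))) ⟩
        N * (n * n) + N * (q * D₂) + N * (n * n)          ≡⟨ collect N (n * n) (q * D₂) ⟩
        N * (2 * (n * n) + q * D₂)                        ∎)
        where
        open ≤-Reasoning
        D₂ = ∑ V (λ x → degree x * degree x)
        front : ∀ a b c → a * (b * c) ≡ c * (b * a)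
        front = solve-∀
        split : ∀ x q f N → x * (q * f + N) ≡ q * (x * f) + N * x
        split = solve-∀
        collect : ∀ N a b → N * a + N * b + N * a ≡ N * (2 * a + b)
        collect = solve-∀

      private
        module DC = DegreeConcentration Adj? adj-sym {t} {q} {{n≢0}} (≤-trans (s≤s (s≤s z≤n)) (m≤n+m 10 (6 * r))) noPathAdj

      S₀ : Subset n
      S₀ = fromDec DC.large?

      missing-small : ∀ {S A x} → S₀ ⊆ˢ S → ∣ A ∩ S ∣ ≡ 0 → x ∈ˢ A → 2 * degree x < n
      missing-small {S} {A} {x} S₀⊆S A∩S≡0 x∈A = ≰⇒> λ large →
        <⇒≱ (s≤s z≤n) (begin
          1              ≡⟨ Subₚ.∣⁅x⁆∣≡1 x ⟨
          ∣ ⁅ x ⁆ ∣      ≤⟨ Subₚ.p⊆q⇒∣p∣≤∣q∣ (λ y∈ → subst (_∈ˢ A ∩ S) (sym (Subₚ.x∈⁅y⁆⇒x≡y x y∈))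
                              (Subₚ.x∈p∩q⁺ (x∈A , S₀⊆S (∈-fromDec⁺ DC.large? large)))) ⟩
          ∣ A ∩ S ∣      ≡⟨ A∩S≡0 ⟩
          0              ∎)
        where open ≤-Reasoning

      smallSquares : ℕ
      smallSquares = ∑ V (λ x → ⟦ DC.small? x ⟧ * (degree x * degree x))

      -- A member that misses `S` contains no vertex of degree at least n/2, so its centre has small
      -- degree.
      missCount≤ : ∀ {S} → S₀ ⊆ˢ S → q * (n * n * missCount F S) ≤ N * (n * n) + N * (q * smallSquares)
      missCount≤ {S} S₀⊆S = count DC.small? (Uniqueₚ.filter⁺ misses? (distinct F)) (All.tabulate λ A∈ →
        let A∈E , A∩S≡0 = ∈-filter⁻ misses? {xs = E} A∈ in A∈E , missing-small S₀⊆S A∩S≡0)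
        where
        misses? : ∀ A → Dec (∣ A ∩ S ∣ ≡ 0)
        misses? A = ∣ A ∩ S ∣ ≟ 0

      module _ (dense : q * t * N ≤ q * size F + N) where

        smallSquares≤ : q * smallSquares ≤ 5 * (n * n)
        smallSquares≤ = DC.small-degrees≤ qK≤n (dense² dense)

        ∣S₀∣≤t : ∣ S₀ ∣ ≤ t
        ∣S₀∣≤t = ≤-trans
          (∣∣≤length S₀ (filter DC.large? V) λ {x} x∈ → ∈-filter⁺ DC.large? (∈-allFin x) (∈-fromDec⁻ DC.large? x∈))
          (DC.large-degrees≤ qK≤n (dense² dense) (m≤n+m 10 (6 * r)))

        superset : ∃[ S ] (S₀ ⊆ˢ S × ∣ S ∣ ≡ t)
        superset = superset-of-size S₀ ∣S₀∣≤t t≤n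

        stability : ∃[ S ] (∣ S ∣ ≡ t × r * missCount F S ≤ N)
        stability = proj₁ superset , proj₂ (proj₂ superset) ,
          rescale r (n * n) N (missCount F (proj₁ superset)) smallSquares {{m*n≢0 n n {{n≢0}} {{n≢0}}}}
            (missCount≤ (proj₁ (proj₂ superset))) smallSquares≤

open Kernels using (module Stability)
open import Data.Fin using (suc)
import Data.Fin.Properties as Finₚ
open import Data.Integer as ℤ using (+_; -[1+_])
import Data.Integer.Properties as ℤₚ
import Data.Nat as ℕ
import Data.Nat.Properties as ℕₚ
import Data.Nat.Tactic.RingSolver as ℕ-Solver
import Data.Integer.Tactic.RingSolver as ℤ-Solver
open import Data.Nat using (ℕ; _≥_; _∸_) renaming (_+_ to _+ℕ_; _*_ to _*ℕ_)
open import Data.Nat.Combinatorics using (_C_)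
open import Data.Fin.Subset using (Subset; ∣_∣)
open import Data.Rational using (ℚ; 0ℚ; _<_; _≤_; _*_; _-_; -_; mkℚ; toℚᵘ; fromℚᵘ; positive)
import Data.Rational.Properties as ℚₚ
open import Data.Rational.Unnormalised as ℚᵘ using (mkℚᵘ; *≤*; *<*)
import Data.Rational.Unnormalised.Properties as ℚᵘₚ
open import Data.Product using (_×_; _,_; proj₁; proj₂; ∃; ∃-syntax)
open import Data.Sum using (_⊎_; inj₁; inj₂)
open import Function using (_∘_)
open import Relation.Binary.PropositionalEquality
open import Relation.Nullary using (¬_)

-- Translation between rational and natural inequalities, and the theorem

toℚᵘ-toℚ : ∀ m → toℚᵘ (toℚ m) ℚᵘ.≃ mkℚᵘ (+ m) 0
toℚᵘ-toℚ m = ℚₚ.toℚᵘ-fromℚᵘ (mkℚᵘ (+ m) 0)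

-- The second argument of `mkℚᵘ` is the denominator minus one, so this is 1/(d + 1).
unitFraction : ℕ → ℚ
unitFraction d = fromℚᵘ (mkℚᵘ (+ 1) d)

0<unitFraction : ∀ d → 0ℚ < unitFraction d
0<unitFraction d = ℚₚ.toℚᵘ-cancel-<
  (ℚᵘₚ.<-respʳ-≃ (ℚᵘₚ.≃-sym (ℚₚ.toℚᵘ-fromℚᵘ (mkℚᵘ (+ 1) d))) (*<* (ℤ.+<+ (ℕ.s≤s ℕ.z≤n))))

-- The negative term is moved to the right-hand side, so that the bound is one about natural numbers.
density-bound : ∀ t d N f → (toℚ t - unitFraction d) * toℚ N ≤ toℚ f → ℕ.suc d *ℕ t *ℕ N ℕ.≤ ℕ.suc d *ℕ f +ℕ N
density-bound t d N f h = ℤₚ.drop‿+≤+ (begin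
  + (ℕ.suc d *ℕ t *ℕ N)                                              ≡⟨ trans (ℤₚ.pos-* (ℕ.suc d *ℕ t) N) (cong (ℤ._* + N) (ℤₚ.pos-* (ℕ.suc d) t)) ⟩
  + ℕ.suc d ℤ.* + t ℤ.* + N                                          ≡⟨ left (+ ℕ.suc d) (+ t) (+ N) ⟩
  (+ t ℤ.* + ℕ.suc d ℤ.+ -[1+ 0 ] ℤ.* + 1) ℤ.* + N ℤ.* + 1 ℤ.+ + N   ≤⟨ ℤₚ.+-monoˡ-≤ (+ N) (ℚᵘₚ.drop-*≤* unnormalised) ⟩
  + f ℤ.* (+ (1 *ℕ ℕ.suc d *ℕ 1)) ℤ.+ + N                            ≡⟨ cong (ℤ._+ + N) (trans (sym (ℤₚ.pos-* f _)) (cong +_ (right f (ℕ.suc d)))) ⟩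
  + (ℕ.suc d *ℕ f) ℤ.+ + N                                           ≡⟨ ℤₚ.pos-+ (ℕ.suc d *ℕ f) N ⟨
  + (ℕ.suc d *ℕ f +ℕ N)                                              ∎)
  where
  open ℤₚ.≤-Reasoning
  left : ∀ d t N → d ℤ.* t ℤ.* N ≡ (t ℤ.* d ℤ.+ -[1+ 0 ] ℤ.* + 1) ℤ.* N ℤ.* + 1 ℤ.+ N
  left = ℤ-Solver.solve-∀
  right : ∀ f d → f *ℕ (1 *ℕ d *ℕ 1) ≡ d *ℕ f
  right = ℕ-Solver.solve-∀
  unnormalised : (mkℚᵘ (+ t) 0 ℚᵘ.- mkℚᵘ (+ 1) d) ℚᵘ.* mkℚᵘ (+ N) 0 ℚᵘ.≤ mkℚᵘ (+ f) 0
  unnormalised = ℚᵘₚ.≤-respˡ-≃ value (ℚᵘₚ.≤-respʳ-≃ (toℚᵘ-toℚ f) (ℚₚ.toℚᵘ-mono-≤ h))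
    where
    value : toℚᵘ ((toℚ t - unitFraction d) * toℚ N) ℚᵘ.≃ (mkℚᵘ (+ t) 0 ℚᵘ.- mkℚᵘ (+ 1) d) ℚᵘ.* mkℚᵘ (+ N) 0
    value = ℚᵘₚ.≃-trans (ℚₚ.toℚᵘ-homo-* (toℚ t - unitFraction d) (toℚ N)) (ℚᵘₚ.*-cong
      (ℚᵘₚ.≃-trans (ℚₚ.toℚᵘ-homo-+ (toℚ t) (- unitFraction d)) (ℚᵘₚ.+-cong (toℚᵘ-toℚ t)
        (ℚᵘₚ.≃-trans (ℚₚ.toℚᵘ-homo‿- (unitFraction d)) (ℚᵘₚ.-‿cong (ℚₚ.toℚᵘ-fromℚᵘ (mkℚᵘ (+ 1) d))))))
      (toℚᵘ-toℚ N))

-- The denominator of ε serves as `r`: its numerator is at least 1, so 1/r ≤ ε.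
fraction-bound : ∀ ε → 0ℚ < ε → ∃[ r ] (∀ a N → r *ℕ a ℕ.≤ N → toℚ a ≤ ε * toℚ N)
fraction-bound (mkℚ (+ 0)         d _) 0<ε with () ← positive 0<ε
fraction-bound (mkℚ (-[1+ _ ])    d _) 0<ε with () ← positive 0<ε
fraction-bound ε@(mkℚ (+ ℕ.suc p) d _) 0<ε = ℕ.suc d , λ a N da≤N → ℚₚ.toℚᵘ-cancel-≤
  (ℚᵘₚ.≤-respˡ-≃ (ℚᵘₚ.≃-sym (toℚᵘ-toℚ a)) (ℚᵘₚ.≤-respʳ-≃ (ℚᵘₚ.≃-sym (value N)) (*≤* (begin
    + a ℤ.* + (ℕ.suc d *ℕ 1)          ≡⟨ ℤₚ.pos-* a (ℕ.suc d *ℕ 1) ⟨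
    + (a *ℕ (ℕ.suc d *ℕ 1))           ≤⟨ ℤ.+≤+ (ℕₚ.≤-trans (ℕₚ.≤-reflexive (lemma a (ℕ.suc d))) (ℕₚ.≤-trans da≤N (ℕₚ.m≤n*m N (ℕ.suc p)))) ⟩
    + (ℕ.suc p *ℕ N)                  ≡⟨ ℤₚ.pos-* (ℕ.suc p) N ⟩
    + ℕ.suc p ℤ.* + N                 ≡⟨ ℤₚ.*-identityʳ _ ⟨
    + ℕ.suc p ℤ.* + N ℤ.* + 1         ∎))))
  where
  open ℤₚ.≤-Reasoning
  lemma : ∀ a d → a *ℕ (d *ℕ 1) ≡ d *ℕ a
  lemma = ℕ-Solver.solve-∀
  value : ∀ N → toℚᵘ (ε * toℚ N) ℚᵘ.≃ mkℚᵘ (+ ℕ.suc p) d ℚᵘ.* mkℚᵘ (+ N) 0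
  value N = ℚᵘₚ.≃-trans (ℚₚ.toℚᵘ-homo-* ε (toℚ N)) (ℚᵘₚ.*-congˡ {mkℚᵘ (+ ℕ.suc p) d} (toℚᵘ-toℚ N))

shorten-path : ∀ {n k ℓ} {F : KFamily n k} → ContainsPath (ℕ.suc ℓ) F → ContainsPath ℓ F
shorten-path (P , (injective , meet , disjoint) , P∈) =
  P ∘ suc ,
  ((λ eq → Finₚ.suc-injective (injective eq)) ,
   (λ i j j≡1+i → meet (suc i) (suc j) (cong ℕ.suc j≡1+i)) ,
   (λ i j i<j → disjoint (suc i) (suc j) (ℕ.s≤s i<j))) ,
  P∈ ∘ suc

theorem5p1 : (k t : ℕ) → k ≥ 4 → t ≥ 1 → (ε : ℚ) → 0ℚ < ε →
    ∃[ δ ] (0ℚ < δ × ∃[ n₀ ] (∀ (n : ℕ) → n ≥ n₀ → (F : KFamily n k) →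
    (¬ ContainsPath (2 *ℕ t +ℕ 2) F ⊎ ¬ ContainsPath (2 *ℕ t +ℕ 1) F) →
    (toℚ t - δ) * toℚ (n C (k ∸ 1)) ≤ toℚ (size F) →
    ∃[ S ] (∣ S ∣ ≡ t × toℚ (missCount F S) ≤ ε * toℚ (n C (k ∸ 1)))))
theorem5p1 (ℕ.suc ℕ.zero) _ (ℕ.s≤s ())
theorem5p1 (ℕ.suc (ℕ.suc k′)) t k≥4 _ ε 0<ε =
  unitFraction d , 0<unitFraction d , Stability.n₀ k′ t r k≥4 , λ n n≥n₀ F noPath dense →
    let S , ∣S∣≡t , miss≤ = Stability.stability k′ t r k≥4 n≥n₀ F (free F noPath)
                              (subst (λ q → q *ℕ t *ℕ (n C ℕ.suc k′) ℕ.≤ q *ℕ size F +ℕ (n C ℕ.suc k′)) 1+d≡q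
                                (density-bound t d (n C ℕ.suc k′) (size F) dense))
    in S , ∣S∣≡t , proj₂ (fraction-bound ε 0<ε) (missCount F S) (n C ℕ.suc k′) miss≤
  where
  r = proj₁ (fraction-bound ε 0<ε)
  -- One less than q = 6r + 10, so that δ = 1/(d + 1) = 1/q.
  d = 6 *ℕ r +ℕ 9
  1+d≡q : ℕ.suc d ≡ 6 *ℕ r +ℕ 10
  1+d≡q = sym (ℕₚ.+-suc (6 *ℕ r) 9)
  free : ∀ {n} (F : KFamily n (ℕ.suc (ℕ.suc k′))) → ¬ ContainsPath (2 *ℕ t +ℕ 2) F ⊎ ¬ ContainsPath (2 *ℕ t +ℕ 1) F →
         ¬ ContainsPath (ℕ.suc t *ℕ 2) F
  free F (inj₁ noPath) path = noPath (subst (λ ℓ → ContainsPath ℓ F) (lemma t) path)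
    where
    lemma : ∀ t → ℕ.suc t *ℕ 2 ≡ 2 *ℕ t +ℕ 2
    lemma = ℕ-Solver.solve-∀
  -- Dropping the first edge of a path with 2t + 2 edges reduces this case to the excluded length 2t
  -- + 1.
  free F (inj₂ noPath) path = noPath (subst (λ ℓ → ContainsPath ℓ F) (lemma t) (shorten-path {F = F} path))
    where
    lemma : ∀ t → 1 +ℕ t *ℕ 2 ≡ 2 *ℕ t +ℕ 1
    lemma = ℕ-Solver.solve-∀
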